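{- For all integers $n\ge0$, $\alpha\ge0$ and $\beta\ge1$: \begin{align*} &\overline{S_3}(3n)\equiv\overline{S_3}(n)\pmod 4,\\ &\overline{S_3}\big(2^\alpha(3n+j)\big)\equiv\overline{S_3}(3n+j)\pmod 4\quad\text{for each } j\in\{0,1,2\},\\ &\overline{S_3}\big(2^{2\beta+j}(3n+2)\big)\equiv\overline{S_3}\big(2^j(3n+2)\big)\pmod 8\quad\text{for } j\in\{0,1\}. \end{align*}
   Context: For $|q|<1$ and a positive integer $k$, write $f_k=\prod_{j\ge1}(1-q^{kj})$. The function $\overline{S_3}(n)$ (number of $3$-Schur overpartitions of $n$) is defined by $\sum_{n\ge0}\overline{S_3}(n)q^n=\prod_{n\ge1}\frac{(1+q^{2n-1})(1-q^{3(2n-1)})}{(1+q^{3(2n-1)})(1-q^{2n-1})}=\frac{f_2^3f_3^2f_{12}}{f_1^2f_4f_6^3}$. -}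

module Defs where

open import Data.Nat as ℕ using (ℕ; zero; suc; _∸_; _%_)
open import Data.Integer as ℤ using (ℤ; +_; -_; _+_; _*_; -1ℤ; 0ℤ; 1ℤ)
open import Data.Bool using (Bool; true; false; if_then_else_)

-- Formal power series in q with integer coefficients: n ↦ coefficient of q^n.
Series : Set
Series = ℕ → ℤ

one : Series
one zero    = 1ℤ
one (suc _) = 0ℤ

convSum : Series → Series → ℕ → ℕ → ℤ
convSum a b n zero    = a 0 * b n
convSum a b n (suc i) = a (suc i) * b (n ∸ suc i) + convSum a b n i

_·_ : Series → Series → Series
(a · b) n = convSum a b n n

infixl 7 _·_

divides? : ℕ → ℕ → Bool
divides? zero    n = false
divides? (suc m) n = n % suc m ℕ.≡ᵇ 0

-- 1 + ε q^m, with ε = ±1 and m ≥ 1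
binom : ℤ → ℕ → Series
binom ε m zero = 1ℤ
binom ε m (suc n) = if suc n ℕ.≡ᵇ m then ε else 0ℤ

-- 1 / (1 - ε q^m) = Σ_k ε^k q^{mk}, for m ≥ 1
sgnPow : ℤ → ℕ → ℤ
sgnPow ε zero    = 1ℤ
sgnPow ε (suc k) = ε * sgnPow ε k

geom : ℤ → ℕ → Series
geom ε (suc m) n = if divides? (suc m) n then sgnPow ε (n ℕ./ suc m) else 0ℤ
geom ε zero    n = one n   -- unused (m ≥ 1 always)

-- k-th factor of the product, with odd part m = 2k+1 (i.e. 2n-1 for n = k+1):
-- (1+q^m)(1-q^{3m}) / ((1+q^{3m})(1-q^m))
factor : ℕ → Series
factor k = binom 1ℤ m · binom -1ℤ (3 ℕ.* m) · geom -1ℤ (3 ℕ.* m) · geom 1ℤ m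
  where m = suc (2 ℕ.* k)

partialProd : ℕ → Series
partialProd zero    = one
partialProd (suc N) = partialProd N · factor N

-- S̄₃(n): the coefficient of q^n in the infinite product.  Factors with
-- odd part m > n are ≡ 1 mod q^{n+1}, so the first n+1 factors determine it.
S3bar : ℕ → ℤ
S3bar n = partialProd (suc n) n

{-# OPTIONS --safe #-}

-- Write φ(q) for the theta series Σ q^(j²) over all integers j.  By Gauss, φ(−q) = Π (1 − q^k)/(1 + q^k), so the
-- generating function of S̄₃ is φ(−q²) φ(−q³) / (φ(−q) φ(−q⁶)).  Gauss's product is obtained from a finite
-- telescoping identity of Shanks type.  Expanding with φ(−q^r) = 1 + 2 Σ_{j≥1} (−1)^j q^(r j²) expresses S̄₃(n)
-- modulo 8 by the numbers of representations of n as r x² or r x² + t y² in positive integers.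
-- Modulo 4 only n = x², 2x², 3x², 6x² count, a condition invariant under multiplication by 2 and 3.
-- Modulo 8, for n ≡ 2 (mod 3) and for even n ≡ 1 (mod 3), every representation of 4n that matters is twice one of n,
-- except for the solutions of 2x² + 6y² = 4n in odd x, y when n ≡ 2.  Multiplication by a sixth root of unity in ℤ[(1+√−3)/2] induces an
-- involution on these; its fixed points x = y match the sign change (−1)^x in the terms 2x² = n.
module Submission where

open import Defs
open import Algebra.Bundles using (CommutativeRing)
open import Algebra.Solver.Ring.AlmostCommutativeRing using (fromCommutativeRing; _-Raw-AlmostCommutative⟶_)
import Algebra.Solver.Ring as RingSolver
import Algebra.Properties.Semiring.Exp as Exp
import Algebra.Properties.CommutativeSemiring.Exp as CommExp
import Relation.Binary.Reasoning.Setoid as SetoidReasoning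
open import Data.Nat as ℕ using (ℕ; zero; suc; _≤_; _<_; z≤n; s≤s)
import Data.Nat.Properties as ℕ
import Data.Nat.DivMod as ℕ
import Data.Nat.Divisibility as ℕᵈ
open import Data.Nat.Primality using (Prime; prime?; euclidsLemma)
open import Data.Nat.Solver using () renaming (module +-*-Solver to ℕS)
open import Data.Integer as ℤ using (ℤ; +_; 0ℤ; 1ℤ; -1ℤ)
import Data.Integer.Properties as ℤ
import Data.Integer.Divisibility.Signed as Signed
open import Data.Integer.Solver using () renaming (module +-*-Solver to ℤS)
open import Data.Bool using (true; false; if_then_else_)
open import Data.Empty using (⊥)
open import Data.Maybe using (Maybe; just; nothing)
open import Data.Product using (_×_; _,_; proj₁; proj₂; ∃; ∃₂)
open import Data.Sum using (_⊎_; inj₁; inj₂; [_,_]′)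
open import Function using (_∘_)
open import Level using (0ℓ)
open import Relation.Nullary using (Dec; yes; no; ¬_; contradiction; ¬?; _×-dec_; _⊎-dec_; _→-dec_)
open import Relation.Nullary.Decidable using (True; toWitness; from-yes; from-no; map′)
open import Relation.Binary using (tri<; tri≈; tri>)
open import Relation.Binary.PropositionalEquality as ≡ using (_≡_)

-- No limits are taken. For the coefficient at q^n the work is done modulo 8 and modulo q^(n+1):
-- every 1 ± q^m is a unit with explicit inverse, and the finite identity behind Gauss's product is
-- exact up to a factor that becomes 1 there. Since 1 + 2A has inverse 1 - 2A + 4A² modulo 8, only
-- linear and quadratic terms in the theta tails survive, and signs matter only in the linear ones.
-- The obstacle in passing from n to 4n for n ≡ 2 (mod 3) is twofold: the signs of the terms 2x² = n
-- are lost, and odd solutions of x² + 3y² = 2n are gained. Both errors carry the factor 4, so it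
-- suffices that the two counts agree in parity. Of the two primitive sixth roots of unity exactly
-- one keeps both coordinates of an odd solution integral and odd. The only failure is x = 3y, whose
-- image has a zero coordinate; it requires 3 to divide n. For n ≡ 1 (mod 3) the dangerous solutions
-- are odd ones of x² + 3y² = 4n. They are excluded by evenness of n, which is why 2(3n + 2) appears
-- in the statement.

module Ring {c ℓ} (R : CommutativeRing c ℓ)
  (ι : ℤ.+-*-rawRing -Raw-AlmostCommutative⟶ fromCommutativeRing R) where

  open CommutativeRing R
  open Exp semiring using (_^_; ^-assocʳ; ^-congˡ; ^-homo-*)
  open CommExp commutativeSemiring using (^-distrib-*)
  open _-Raw-AlmostCommutative⟶_ ι using (⟦_⟧; 0-homo; 1-homo)
  open SetoidReasoning setoid

  coeff≟ : (i j : ℤ) → Maybe (⟦ i ⟧ ≈ ⟦ j ⟧)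
  coeff≟ i j with i ℤ.≟ j
  ... | yes i≡j = just (reflexive (≡.cong ⟦_⟧ i≡j))
  ... | no  _   = nothing

  open RingSolver ℤ.+-*-rawRing (fromCommutativeRing R) ι coeff≟
    using (solve; _:=_; _:+_; _:*_; _:-_; :-_; con)

  -- Images of integer literals instead of `1#`: the solver reads its constants through `⟦_⟧`, which
  -- meets `1#` and `0#` only up to `1-homo` and `0-homo`.
  𝟙 𝟚 : Carrier
  𝟙 = ⟦ + 1 ⟧
  𝟚 = ⟦ + 2 ⟧

  𝟙* : ∀ x → 𝟙 * x ≈ x
  𝟙* x = solve 1 (λ x → con (+ 1) :* x := x) refl x

  sgn : ℕ → Carrier
  sgn zero    = 𝟙
  sgn (suc n) = - sgn n

  -- The ring may have zero divisors, so factors such as 1 + y^(n+1) are cancelled through an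
  -- explicit inverse `v`.
  cancel : ∀ {u v x y} → u * v ≈ 𝟙 → u * x ≈ u * y → x ≈ y
  cancel {u} {v} {x} {y} uv ux≈uy = begin
    x            ≈⟨ sym (𝟙* x) ⟩
    𝟙 * x        ≈⟨ *-congʳ (sym uv) ⟩
    u * v * x    ≈⟨ solve 3 (λ u v x → u :* v :* x := v :* (u :* x)) refl u v x ⟩
    v * (u * x)  ≈⟨ *-congˡ ux≈uy ⟩
    v * (u * y)  ≈⟨ solve 3 (λ u v x → v :* (u :* x) := u :* v :* x) refl u v y ⟩
    u * v * y    ≈⟨ *-congʳ uv ⟩
    𝟙 * y        ≈⟨ 𝟙* y ⟩
    y            ∎

  ^-zero : ∀ {x} k → x ≈ 0# → x ^ suc k ≈ 0#
  ^-zero {x} k x≈0 = trans (*-congʳ x≈0) (zeroˡ (x ^ k))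

  -- Gauss's theta product as a finite identity

  module Gauss (y : Carrier) (p m : ℕ → Carrier)
    (p-inv : ∀ k → (𝟙 + y ^ suc k) * p k ≈ 𝟙)
    (m-inv : ∀ k → (𝟙 - y ^ suc k) * m k ≈ 𝟙) where

    Q V θ : ℕ → Carrier
    Q zero    = 𝟙
    Q (suc n) = Q n * ((𝟙 - y ^ suc n) * p n)
    V zero    = 𝟙
    V (suc n) = V n * ((𝟙 + y ^ suc n) * m n)
    θ zero    = 𝟙
    θ (suc n) = θ n + 𝟚 * sgn (suc n) * (y ^ suc n) ^ suc n

    -- The correction factor of the Shanks-type identity: every summand after the leading 1 contains
    -- y^(n+1). The number of summands `s` is separate from `n` so that `C (suc n) s` can be
    -- compared with `C n s`.
    C : ℕ → ℕ → Carrier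
    C n zero    = 𝟙
    C n (suc s) = C n s + sgn (suc s) * (y ^ suc n) ^ suc s * (V (suc s) + V s)

    Q*V : ∀ n → Q n * V n ≈ 𝟙
    Q*V zero    = 𝟙* 𝟙
    Q*V (suc n) = begin
      Q n * ((𝟙 - Y) * p n) * (V n * ((𝟙 + Y) * m n))
        ≈⟨ solve 5 (λ Q Y p V m →
             Q :* ((con (+ 1) :- Y) :* p) :* (V :* ((con (+ 1) :+ Y) :* m)) :=
             Q :* V :* (((con (+ 1) :+ Y) :* p) :* ((con (+ 1) :- Y) :* m))) refl (Q n) Y (p n) (V n) (m n) ⟩
      Q n * V n * (((𝟙 + Y) * p n) * ((𝟙 - Y) * m n))
        ≈⟨ *-cong (Q*V n) (*-cong (p-inv n) (m-inv n)) ⟩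
      𝟙 * (𝟙 * 𝟙)  ≈⟨ trans (𝟙* _) (𝟙* _) ⟩
      𝟙 ∎
      where Y = y ^ suc n

    Q-step : ∀ n → Q (suc n) * (𝟙 + y ^ suc n) ≈ Q n * (𝟙 - y ^ suc n)
    Q-step n = begin
      Q n * ((𝟙 - Y) * p n) * (𝟙 + Y)
        ≈⟨ solve 3 (λ Q Y p → Q :* ((con (+ 1) :- Y) :* p) :* (con (+ 1) :+ Y) :=
             ((con (+ 1) :+ Y) :* p) :* (Q :* (con (+ 1) :- Y))) refl (Q n) Y (p n) ⟩
      ((𝟙 + Y) * p n) * (Q n * (𝟙 - Y))  ≈⟨ *-congʳ (p-inv n) ⟩
      𝟙 * (Q n * (𝟙 - Y))                ≈⟨ 𝟙* _ ⟩
      Q n * (𝟙 - Y)                      ∎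
      where Y = y ^ suc n

    -- Equivalent to V (n+1) (1 - Y) = V n (1 + Y), arranged so that Y times a sum becomes a
    -- difference; this is what makes `C` telescope.
    V-step : ∀ n → y ^ suc n * (V (suc n) + V n) ≈ V (suc n) - V n
    V-step n = begin
      Y * (V n * ((𝟙 + Y) * m n) + V n)
        ≈⟨ solve 3 (λ V Y m → Y :* (V :* ((con (+ 1) :+ Y) :* m) :+ V) :=
             V :* ((con (+ 1) :+ Y) :* m) :- V :* (((con (+ 1) :- Y) :* m) :+ ((con (+ 1) :- Y) :* m) :* Y :- Y)) refl (V n) Y (m n) ⟩
      V (suc n) - V n * (((𝟙 - Y) * m n) + ((𝟙 - Y) * m n) * Y - Y)
        ≈⟨ +-congˡ (-‿cong (*-congˡ (+-congʳ (+-cong (m-inv n) (*-congʳ (m-inv n)))))) ⟩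
      V (suc n) - V n * (𝟙 + 𝟙 * Y - Y)
        ≈⟨ solve 3 (λ W V Y → W :- V :* (con (+ 1) :+ con (+ 1) :* Y :- Y) := W :- V) refl (V (suc n)) (V n) Y ⟩
      V (suc n) - V n ∎
      where Y = y ^ suc n

    -- With X = y^(n+1) and V = 1/Q this reads (1 + X)(Q (n+1) C (n+1) s − Q n C n s) = −2 (−1)^s X^(s+1) Q n V s,
    -- so that the sum over s defining C telescopes.
    C-step : ∀ n s → (𝟙 - y ^ suc n) * C (suc n) s + 𝟚 * sgn s * (y ^ suc n) ^ suc s * V s
                     ≈ (𝟙 + y ^ suc n) * C n s
    C-step n zero = begin
      (𝟙 - X) * 𝟙 + 𝟚 * 𝟙 * (X * 1#) * 𝟙
        ≈⟨ +-congˡ (*-congʳ (*-congˡ (*-congˡ (sym 1-homo)))) ⟩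
      (𝟙 - X) * 𝟙 + 𝟚 * 𝟙 * (X * 𝟙) * 𝟙
        ≈⟨ solve 1 (λ X → (con (+ 1) :- X) :* con (+ 1)
             :+ con (+ 2) :* con (+ 1) :* (X :* con (+ 1)) :* con (+ 1)
             := (con (+ 1) :+ X) :* con (+ 1)) refl X ⟩
      (𝟙 + X) * 𝟙 ∎
      where X = y ^ suc n
    C-step n (suc s) = begin
      (𝟙 - X) * (C (suc n) s + - σ * (y * X) ^ suc s * (V₁ + V₀)) + 𝟚 * - σ * (X * Z) * V₁
        ≈⟨ +-congʳ (*-congˡ (+-congˡ (*-congʳ (*-congˡ (^-distrib-* y X (suc s)))))) ⟩
      (𝟙 - X) * (C (suc n) s + - σ * (Y * Z) * (V₁ + V₀)) + 𝟚 * - σ * (X * Z) * V₁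
        ≈⟨ solve 7 (λ X Y Z σ V₁ V₀ C →
             (con (+ 1) :- X) :* (C :+ :- σ :* (Y :* Z) :* (V₁ :+ V₀)) :+ con (+ 2) :* :- σ :* (X :* Z) :* V₁
             := (con (+ 1) :- X) :* C :+ con (+ 2) :* σ :* Z :* V₀
                :- σ :* Z :* (con (+ 2) :* V₀ :+ con (+ 2) :* X :* V₁ :+ (con (+ 1) :- X) :* (Y :* (V₁ :+ V₀))))
             refl X Y Z σ V₁ V₀ (C (suc n) s) ⟩
      (𝟙 - X) * C (suc n) s + 𝟚 * σ * Z * V₀
        - σ * Z * (𝟚 * V₀ + 𝟚 * X * V₁ + (𝟙 - X) * (Y * (V₁ + V₀)))
        ≈⟨ +-cong (C-step n s) (-‿cong (*-congˡ (+-congˡ (*-congˡ (V-step s))))) ⟩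
      (𝟙 + X) * C n s - σ * Z * (𝟚 * V₀ + 𝟚 * X * V₁ + (𝟙 - X) * (V₁ - V₀))
        ≈⟨ solve 6 (λ X Z σ V₁ V₀ C →
             (con (+ 1) :+ X) :* C
               :- σ :* Z :* (con (+ 2) :* V₀ :+ con (+ 2) :* X :* V₁ :+ (con (+ 1) :- X) :* (V₁ :- V₀))
             := (con (+ 1) :+ X) :* (C :+ :- σ :* Z :* (V₁ :+ V₀)))
             refl X Z σ V₁ V₀ (C n s) ⟩
      (𝟙 + X) * (C n s + - σ * Z * (V₁ + V₀)) ∎
      where
      X = y ^ suc n
      Y = y ^ suc s
      Z = X ^ suc s
      σ = sgn s
      V₁ = V (suc s)
      V₀ = V s

    -- `C-step` raises the first index of `C`, and in the one additional summand `Q*V` replaces the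
    -- product of `Q` and `V` by 1. What remains is the new theta term 2(-1)^(n+1) y^((n+1)²). Both
    -- sides are multiplied by the unit 1 + X because `Q-step` has no denominators only in that
    -- form.
    Q*C≈θ : ∀ n → Q n * C n n ≈ θ n
    Q*C≈θ zero    = 𝟙* 𝟙
    Q*C≈θ (suc n) = trans (cancel (p-inv n) step) (+-congʳ (Q*C≈θ n))
      where
      X = y ^ suc n
      Z = X ^ n
      σ = sgn n
      V₁ = V (suc n)
      V₀ = V n
      Q₁ = Q (suc n)
      Q₀ = Q n
      C₁ = C (suc n) n
      C₀ = C n n
      step : (𝟙 + X) * (Q₁ * C (suc n) (suc n)) ≈ (𝟙 + X) * (Q₀ * C₀ + 𝟚 * - σ * (X * Z))
      step = begin
        (𝟙 + X) * (Q₁ * (C₁ + - σ * (y * X) ^ suc n * (V₁ + V₀)))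
          ≈⟨ *-congˡ (*-congˡ (+-congˡ (*-congʳ (*-congˡ (^-distrib-* y X (suc n)))))) ⟩
        (𝟙 + X) * (Q₁ * (C₁ + - σ * (X * (X * Z)) * (V₁ + V₀)))
          ≈⟨ solve 7 (λ X Z σ V₁ V₀ Q C →
               (con (+ 1) :+ X) :* (Q :* (C :+ :- σ :* (X :* (X :* Z)) :* (V₁ :+ V₀)))
               := (Q :* (con (+ 1) :+ X)) :* C
                  :- σ :* X :* (X :* Z) :* ((con (+ 1) :+ X) :* (Q :* V₁) :+ (Q :* (con (+ 1) :+ X)) :* V₀))
               refl X Z σ V₁ V₀ Q₁ C₁ ⟩
        (Q₁ * (𝟙 + X)) * C₁ - σ * X * (X * Z) * ((𝟙 + X) * (Q₁ * V₁) + (Q₁ * (𝟙 + X)) * V₀)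
          ≈⟨ +-cong (*-congʳ (Q-step n))
               (-‿cong (*-congˡ (+-cong (*-congˡ (Q*V (suc n))) (*-congʳ (Q-step n))))) ⟩
        (Q₀ * (𝟙 - X)) * C₁ - σ * X * (X * Z) * ((𝟙 + X) * 𝟙 + (Q₀ * (𝟙 - X)) * V₀)
          ≈⟨ solve 6 (λ X Z σ V₀ Q C →
               (Q :* (con (+ 1) :- X)) :* C
                 :- σ :* X :* (X :* Z) :* ((con (+ 1) :+ X) :* con (+ 1) :+ (Q :* (con (+ 1) :- X)) :* V₀)
               := Q :* ((con (+ 1) :- X) :* C :+ con (+ 2) :* σ :* (X :* Z) :* V₀)
                  :- σ :* X :* Z :* (X :+ X :* X :+ (con (+ 2) :+ X :- X :* X) :* (Q :* V₀)))
               refl X Z σ V₀ Q₀ C₁ ⟩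
        Q₀ * ((𝟙 - X) * C₁ + 𝟚 * σ * (X * Z) * V₀)
          - σ * X * Z * (X + X * X + (𝟚 + X - X * X) * (Q₀ * V₀))
          ≈⟨ +-cong (*-congˡ (C-step n n)) (-‿cong (*-congˡ (+-congˡ (*-congˡ (Q*V n))))) ⟩
        Q₀ * ((𝟙 + X) * C₀) - σ * X * Z * (X + X * X + (𝟚 + X - X * X) * 𝟙)
          ≈⟨ solve 5 (λ X Z σ Q C →
               Q :* ((con (+ 1) :+ X) :* C)
                 :- σ :* X :* Z :* (X :+ X :* X :+ (con (+ 2) :+ X :- X :* X) :* con (+ 1))
               := (con (+ 1) :+ X) :* (Q :* C :+ con (+ 2) :* :- σ :* (X :* Z)))
               refl X Z σ Q₀ C₀ ⟩
        (𝟙 + X) * (Q₀ * C₀ + 𝟚 * - σ * (X * Z)) ∎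

    C≈𝟙 : ∀ n s → y ^ suc n ≈ 0# → C n s ≈ 𝟙
    C≈𝟙 n zero    _   = refl
    C≈𝟙 n (suc s) y≈0 = begin
      C n s + - sgn s * (y ^ suc n) ^ suc s * (V (suc s) + V s)
        ≈⟨ +-cong (C≈𝟙 n s y≈0) (*-congʳ (*-congˡ (trans (^-zero s y≈0) (sym 0-homo)))) ⟩
      𝟙 + - sgn s * ⟦ + 0 ⟧ * (V (suc s) + V s)
        ≈⟨ solve 2 (λ σ V → con (+ 1) :+ :- σ :* con (+ 0) :* V := con (+ 1)) refl (sgn s) (V (suc s) + V s) ⟩
      𝟙 ∎

    -- Once y^(n+1) vanishes, the correction factor is 1.
    Q≈θ : ∀ n → y ^ suc n ≈ 0# → Q n ≈ θ n
    Q≈θ n y≈0 = begin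
      Q n            ≈⟨ solve 1 (λ Q → Q := Q :* con (+ 1)) refl (Q n) ⟩
      Q n * 𝟙        ≈⟨ *-congˡ (C≈𝟙 n n y≈0) ⟨
      Q n * C n n    ≈⟨ Q*C≈θ n ⟩
      θ n            ∎

  -- Finite sums and expansion modulo 8

  ∑ : ℕ → (ℕ → Carrier) → Carrier
  ∑ zero    f = ⟦ + 0 ⟧
  ∑ (suc n) f = ∑ n f + f (suc n)

  ∑-cong : ∀ n {f g} → (∀ j → f j ≈ g j) → ∑ n f ≈ ∑ n g
  ∑-cong zero    f≈g = refl
  ∑-cong (suc n) f≈g = +-cong (∑-cong n f≈g) (f≈g (suc n))

  *-distribˡ-∑ : ∀ n x f → x * ∑ n f ≈ ∑ n (λ j → x * f j)
  *-distribˡ-∑ zero    x f = solve 1 (λ x → x :* con (+ 0) := con (+ 0)) refl x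
  *-distribˡ-∑ (suc n) x f = trans (distribˡ x _ _) (+-congʳ (*-distribˡ-∑ n x f))

  *-distribʳ-∑ : ∀ n x f → ∑ n f * x ≈ ∑ n (λ j → f j * x)
  *-distribʳ-∑ zero    x f = solve 1 (λ x → con (+ 0) :* x := con (+ 0)) refl x
  *-distribʳ-∑ (suc n) x f = trans (distribʳ x _ _) (+-congʳ (*-distribʳ-∑ n x f))

  module Mod8 (8≈0 : ⟦ + 8 ⟧ ≈ ⟦ + 0 ⟧) where

    𝟜 : Carrier
    𝟜 = ⟦ + 4 ⟧

    drop-8 : ∀ {x y} z → x ≈ y + ⟦ + 8 ⟧ * z → x ≈ y
    drop-8 {x} {y} z x≈ = begin
      x                   ≈⟨ x≈ ⟩
      y + ⟦ + 8 ⟧ * z     ≈⟨ +-congˡ (*-congʳ 8≈0) ⟩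
      y + ⟦ + 0 ⟧ * z     ≈⟨ solve 2 (λ y z → y :+ con (+ 0) :* z := y) refl y z ⟩
      y                   ∎

    -- Division by 1 + 2A is multiplication by 1 - 2A + 4A², because (1 + 2A)(1 - 2A + 4A²) = 1 +
    -- 8A³. All quadratic terms can be given a plus sign since 4 = -4.
    quotient-mod-8 : ∀ P A B C D →
      P * (𝟙 + 𝟚 * A) * (𝟙 + 𝟚 * D) ≈ (𝟙 + 𝟚 * B) * (𝟙 + 𝟚 * C) →
      P ≈ 𝟙 + 𝟚 * (B + C - A - D)
          + 𝟜 * (A * A + D * D + B * C + A * B + B * D + A * C + C * D + A * D)
    quotient-mod-8 P A B C D eq =
      trans (drop-8 (- (P * (A * A * A + D * D * D + ⟦ + 8 ⟧ * A * A * A * D * D * D)))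
        (solve 3 (λ P A D → P := P :* (con (+ 1) :+ con (+ 2) :* A) :* (con (+ 1) :+ con (+ 2) :* D)
              :* (con (+ 1) :- con (+ 2) :* A :+ con (+ 4) :* A :* A)
              :* (con (+ 1) :- con (+ 2) :* D :+ con (+ 4) :* D :* D)
            :+ con (+ 8) :* :- (P :* (A :* A :* A :+ D :* D :* D :+ con (+ 8) :* A :* A :* A :* D :* D :* D)))
          refl P A D))
      (trans (*-congʳ (*-congʳ eq))
      -- In the product of the two inverses the terms of degree 3 and 4 carry 8 and 16.
      (trans (drop-8 ((𝟙 + 𝟚 * B) * (𝟙 + 𝟚 * C) * (𝟚 * A * A * D * D - A * A * D - A * D * D))
        (solve 4 (λ A B C D →
            (con (+ 1) :+ con (+ 2) :* B) :* (con (+ 1) :+ con (+ 2) :* C)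
              :* (con (+ 1) :- con (+ 2) :* A :+ con (+ 4) :* A :* A)
              :* (con (+ 1) :- con (+ 2) :* D :+ con (+ 4) :* D :* D)
            := (con (+ 1) :+ con (+ 2) :* B) :* (con (+ 1) :+ con (+ 2) :* C)
                 :* (con (+ 1) :- con (+ 2) :* A :- con (+ 2) :* D :+ con (+ 4) :* (A :* A :+ D :* D :+ A :* D))
               :+ con (+ 8) :* ((con (+ 1) :+ con (+ 2) :* B) :* (con (+ 1) :+ con (+ 2) :* C)
                 :* (con (+ 2) :* A :* A :* D :* D :- A :* A :* D :- A :* D :* D)))
          refl A B C D))
        (drop-8 (B * W + C * W + 𝟚 * B * C * W - A * B * C - B * C * D - A * B - A * C - B * D - C * D)
          (solve 4 (λ A B C D → let W = A :* A :+ D :* D :+ A :* D in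
              (con (+ 1) :+ con (+ 2) :* B) :* (con (+ 1) :+ con (+ 2) :* C)
                :* (con (+ 1) :- con (+ 2) :* A :- con (+ 2) :* D :+ con (+ 4) :* W)
              := con (+ 1) :+ con (+ 2) :* (B :+ C :- A :- D)
                   :+ con (+ 4) :* (A :* A :+ D :* D :+ B :* C :+ A :* B :+ B :* D :+ A :* C :+ C :* D :+ A :* D)
                 :+ con (+ 8) :* (B :* W :+ C :* W :+ con (+ 2) :* B :* C :* W
                      :- A :* B :* C :- B :* C :* D :- A :* B :- A :* C :- B :* D :- C :* D))
            refl A B C D))))
      where W = A * A + D * D + A * D

    𝟜*- : ∀ x → 𝟜 * - x ≈ 𝟜 * x
    𝟜*- x = drop-8 (- x) (solve 1 (λ x → con (+ 4) :* :- x := con (+ 4) :* x :+ con (+ 8) :* :- x) refl x)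

    𝟜*sgn : ∀ n x → 𝟜 * (sgn n * x) ≈ 𝟜 * x
    𝟜*sgn zero    x = *-congˡ (𝟙* x)
    𝟜*sgn (suc n) x = begin
      𝟜 * (- sgn n * x)     ≈⟨ solve 2 (λ σ x → con (+ 4) :* (:- σ :* x)
             := con (+ 4) :* (:- (σ :* x))) refl (sgn n) x ⟩
      𝟜 * - (sgn n * x)     ≈⟨ 𝟜*- (sgn n * x) ⟩
      𝟜 * (sgn n * x)       ≈⟨ 𝟜*sgn n x ⟩
      𝟜 * x                 ∎

    𝟜*∑sgn : ∀ n f → 𝟜 * ∑ n (λ j → sgn j * f j) ≈ 𝟜 * ∑ n f
    𝟜*∑sgn zero    f = refl
    𝟜*∑sgn (suc n) f =
        trans (distribˡ 𝟜 _ _) (trans (+-cong (𝟜*∑sgn n f) (𝟜*sgn (suc n) (f (suc n)))) (sym (distribˡ 𝟜 _ _)))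

    -- Squaring is additive modulo 2, and the factor 4 lifts this to modulo 8.
    𝟜*∑² : ∀ n f → 𝟜 * (∑ n f * ∑ n f) ≈ 𝟜 * ∑ n (λ j → f j * f j)
    𝟜*∑² zero    f = *-congˡ (solve 0 (con (+ 0) :* con (+ 0) := con (+ 0)) refl)
    𝟜*∑² (suc n) f = begin
      𝟜 * ((∑ n f + x) * (∑ n f + x))
        ≈⟨ drop-8 (∑ n f * x) (solve 2 (λ s x → con (+ 4) :* ((s :+ x) :* (s :+ x))
             := con (+ 4) :* (s :* s) :+ con (+ 4) :* (x :* x) :+ con (+ 8) :* (s :* x)) refl (∑ n f) x) ⟩
      𝟜 * (∑ n f * ∑ n f) + 𝟜 * (x * x)
        ≈⟨ +-congʳ (𝟜*∑² n f) ⟩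
      𝟜 * ∑ n (λ j → f j * f j) + 𝟜 * (x * x)
        ≈⟨ sym (distribˡ 𝟜 _ _) ⟩
      𝟜 * (∑ n (λ j → f j * f j) + x * x) ∎
      where x = f (suc n)

  -- The 3-Schur product as a quotient of theta products

  module Product (q : Carrier) (a b : ℕ → Carrier)
    (a-inv : ∀ m .{{_ : ℕ.NonZero m}} → (𝟙 + q ^ m) * a m ≈ 𝟙)
    (b-inv : ∀ m .{{_ : ℕ.NonZero m}} → (𝟙 - q ^ m) * b m ≈ 𝟙) where

    -- `Q r` is the partial product of φ(-q^r). `G r` runs over odd m only, with factors (1 +
    -- q^(rm))/(1 - q^(rm)), so that `P` is `G 1` divided by `G 3`.
    Q G : ℕ → ℕ → Carrier
    Q r zero    = 𝟙
    Q r (suc n) = Q r n * ((𝟙 - q ^ (r ℕ.* suc n)) * a (r ℕ.* suc n))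
    G r zero    = 𝟙
    G r (suc n) = G r n * ((𝟙 + q ^ (r ℕ.* suc (2 ℕ.* n))) * b (r ℕ.* suc (2 ℕ.* n)))

    P : ℕ → Carrier
    P zero    = 𝟙
    P (suc n) = P n * ((𝟙 + q ^ m) * (𝟙 - q ^ (3 ℕ.* m)) * a (3 ℕ.* m) * b m)
      where m = suc (2 ℕ.* n)

    S T : ℕ → ℕ → Carrier
    S r n = ∑ n (λ j → sgn j * q ^ (r ℕ.* (j ℕ.* j)))
    T r n = ∑ n (λ j → q ^ (r ℕ.* (j ℕ.* j)))

    TT : ℕ → ℕ → ℕ → Carrier
    TT r t n = ∑ n (λ i → ∑ n (λ j → q ^ (r ℕ.* (i ℕ.* i) ℕ.+ t ℕ.* (j ℕ.* j))))

    θ : ℕ → ℕ → Carrier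
    θ r n = 𝟙 + 𝟚 * S r n

    q^ : ∀ {m n} → m ≡ n → q ^ m ≈ q ^ n
    q^ m≡n = reflexive (≡.cong (q ^_) m≡n)

    -- `G r n` cancels the factors of odd index in `Q r (2 * n)`, and the factor of even index 2k is
    -- the k-th factor of `Q (r * 2)`; hence the two different lengths.
    Q*G : ∀ r n .{{_ : ℕ.NonZero r}} → Q r (2 ℕ.* n) * G r n ≈ Q (r ℕ.* 2) n
    Q*G r zero    = 𝟙* 𝟙
    Q*G r (suc n) = begin
      Q r (2 ℕ.* suc n) * (G r n * ((𝟙 + q ^ m) * b m))
        ≈⟨ *-congʳ (reflexive (≡.cong (Q r) (ℕ.*-suc 2 n))) ⟩
      Q r (2 ℕ.* n) * ((𝟙 - q ^ m) * a m) * (E * A) * (G r n * ((𝟙 + q ^ m) * b m))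
        ≈⟨ solve 7 (λ Q x a E A G b →
             Q :* ((con (+ 1) :- x) :* a) :* (E :* A) :* (G :* ((con (+ 1) :+ x) :* b))
             := ((con (+ 1) :+ x) :* a) :* ((con (+ 1) :- x) :* b) :* (Q :* G) :* (E :* A))
             refl (Q r (2 ℕ.* n)) (q ^ m) (a m) E A (G r n) (b m) ⟩
      ((𝟙 + q ^ m) * a m) * ((𝟙 - q ^ m) * b m) * (Q r (2 ℕ.* n) * G r n) * (E * A)
        ≈⟨ *-congʳ (*-cong (*-cong (a-inv m) (b-inv m)) (Q*G r n)) ⟩
      𝟙 * 𝟙 * Q (r ℕ.* 2) n * (E * A)
        ≈⟨ *-congʳ (trans (*-congʳ (𝟙* 𝟙)) (𝟙* _)) ⟩
      Q (r ℕ.* 2) n * (E * A)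
        ≈⟨ *-congˡ (reflexive (≡.cong (λ k → (𝟙 - q ^ k) * a k) r*m+1)) ⟩
      Q (r ℕ.* 2) (suc n) ∎
      where
      m = r ℕ.* suc (2 ℕ.* n)
      E = 𝟙 - q ^ (r ℕ.* suc (suc (2 ℕ.* n)))
      A = a (r ℕ.* suc (suc (2 ℕ.* n)))
      r*m+1 : r ℕ.* suc (suc (2 ℕ.* n)) ≡ r ℕ.* 2 ℕ.* suc n
      r*m+1 = ≡.trans (≡.cong (r ℕ.*_) (≡.sym (ℕ.*-suc 2 n))) (≡.sym (ℕ.*-assoc r 2 (suc n)))
      instance
        m≢0 : ℕ.NonZero m
        m≢0 = ℕ.m*n≢0 r (suc (2 ℕ.* n))

    P*G₃ : ∀ n → P n * G 3 n ≈ G 1 n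
    P*G₃ zero    = 𝟙* 𝟙
    P*G₃ (suc n) = begin
      P n * ((𝟙 + x) * (𝟙 - x₃) * a₃ * b m) * (G 3 n * ((𝟙 + x₃) * b₃))
        ≈⟨ solve 7 (λ P G x x₃ a₃ b₃ b →
             P :* ((con (+ 1) :+ x) :* (con (+ 1) :- x₃) :* a₃ :* b) :* (G :* ((con (+ 1) :+ x₃) :* b₃))
             := (P :* G) :* ((con (+ 1) :+ x) :* b)
                :* (((con (+ 1) :+ x₃) :* a₃) :* ((con (+ 1) :- x₃) :* b₃)))
             refl (P n) (G 3 n) x x₃ a₃ b₃ (b m) ⟩
      (P n * G 3 n) * ((𝟙 + x) * b m) * (((𝟙 + x₃) * a₃) * ((𝟙 - x₃) * b₃))
        ≈⟨ *-cong (*-congʳ (P*G₃ n)) (*-cong (a-inv (3 ℕ.* m)) (b-inv (3 ℕ.* m))) ⟩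
      G 1 n * ((𝟙 + x) * b m) * (𝟙 * 𝟙)
        ≈⟨ solve 1 (λ x → x :* (con (+ 1) :* con (+ 1)) := x) refl _ ⟩
      G 1 n * ((𝟙 + x) * b m)
        ≈⟨ *-congˡ (reflexive (≡.cong (λ k → (𝟙 + q ^ k) * b k) (≡.sym (ℕ.*-identityˡ m)))) ⟩
      G 1 (suc n) ∎
      where
      m = suc (2 ℕ.* n)
      x = q ^ m
      x₃ = q ^ (3 ℕ.* m)
      a₃ = a (3 ℕ.* m)
      b₃ = b (3 ℕ.* m)

    P*Q*Q : ∀ n → P n * Q 1 (2 ℕ.* n) * Q 6 n ≈ Q 2 n * Q 3 (2 ℕ.* n)
    P*Q*Q n = begin
      P n * Q 1 (2 ℕ.* n) * Q 6 n
        ≈⟨ *-congˡ (Q*G 3 n) ⟨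
      P n * Q 1 (2 ℕ.* n) * (Q 3 (2 ℕ.* n) * G 3 n)
        ≈⟨ solve 4 (λ P Q₁ Q₃ G₃ → P :* Q₁ :* (Q₃ :* G₃) := Q₁ :* (P :* G₃) :* Q₃)
             refl (P n) (Q 1 (2 ℕ.* n)) (Q 3 (2 ℕ.* n)) (G 3 n) ⟩
      Q 1 (2 ℕ.* n) * (P n * G 3 n) * Q 3 (2 ℕ.* n)
        ≈⟨ *-congʳ (*-congˡ (P*G₃ n)) ⟩
      Q 1 (2 ℕ.* n) * G 1 n * Q 3 (2 ℕ.* n)
        ≈⟨ *-congʳ (Q*G 1 n) ⟩
      Q 2 n * Q 3 (2 ℕ.* n) ∎

    module Truncated (d : ℕ) (q^≈0 : ∀ k → d ℕ.< k → q ^ k ≈ 0#) (8≈0 : ⟦ + 8 ⟧ ≈ ⟦ + 0 ⟧) where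

      open Mod8 8≈0

      -- The exponent r j² of a term is at least j, so terms with j beyond `d` vanish.
      θ-shift : ∀ r e .{{_ : ℕ.NonZero r}} → θ r (e ℕ.+ d) ≈ θ r d
      θ-shift r zero    = refl
      θ-shift r (suc e) = begin
        𝟙 + 𝟚 * (S r (e ℕ.+ d) + sgn j * q ^ (r ℕ.* (j ℕ.* j)))
          ≈⟨ +-congˡ (*-congˡ (+-congˡ (*-congˡ (trans (q^≈0 _ d<) (sym 0-homo))))) ⟩
        𝟙 + 𝟚 * (S r (e ℕ.+ d) + sgn j * ⟦ + 0 ⟧)
          ≈⟨ solve 2 (λ S σ → con (+ 1) :+ con (+ 2) :* (S :+ σ :* con (+ 0)) := con (+ 1) :+ con (+ 2) :* S)
               refl (S r (e ℕ.+ d)) (sgn j) ⟩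
        θ r (e ℕ.+ d)
          ≈⟨ θ-shift r e ⟩
        θ r d ∎
        where
        j = suc (e ℕ.+ d)
        d< : d ℕ.< r ℕ.* (j ℕ.* j)
        d< = ℕ.≤-trans (ℕ.s≤s (ℕ.m≤n+m d e)) (ℕ.≤-trans (ℕ.m≤m*n j j) (ℕ.m≤n*m (j ℕ.* j) r))

      θ-stable : ∀ r n .{{_ : ℕ.NonZero r}} → d ℕ.≤ n → θ r n ≈ θ r d
      θ-stable r n d≤n = trans (reflexive (≡.cong (θ r) (≡.sym (ℕ.m∸n+n≡m d≤n)))) (θ-shift r (n ℕ.∸ d))

      Q≈θ : ∀ r n .{{_ : ℕ.NonZero r}} → d ℕ.≤ n → Q r n ≈ θ r n
      Q≈θ r n d≤n = begin
        Q r n             ≈⟨ Q≈ n ⟩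
        Y.Q n    ≈⟨ Y.Q≈θ n (trans (^-assocʳ q r (suc n)) (q^≈0 _ (ℕ.≤-trans (ℕ.s≤s d≤n) (ℕ.m≤n*m (suc n) r)))) ⟩
        Y.θ n    ≈⟨ θ≈ n ⟩
        θ r n             ∎
        where
        -- Transports inverses of 1 ± q^(r(k+1)) to inverses of 1 ± (q^r)^(k+1); `s` is the identity
        -- or negation.
        inv : ∀ (c : ℕ → Carrier) (s : Carrier → Carrier) → (∀ {x y} → x ≈ y → s x ≈ s y) →
              (∀ m .{{_ : ℕ.NonZero m}} → (𝟙 + s (q ^ m)) * c m ≈ 𝟙) →
              ∀ k → (𝟙 + s ((q ^ r) ^ suc k)) * c (r ℕ.* suc k) ≈ 𝟙
        inv c s s-cong c-inv k = trans (*-congʳ (+-congˡ (s-cong (^-assocʳ q r (suc k)))))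
                                       (c-inv (r ℕ.* suc k) {{ℕ.m*n≢0 r (suc k)}})
        module Y = Gauss (q ^ r) (λ k → a (r ℕ.* suc k)) (λ k → b (r ℕ.* suc k))
                         (inv a (λ x → x) (λ p → p) a-inv) (inv b -_ -‿cong b-inv)
        Q≈ : ∀ n → Q r n ≈ Y.Q n
        Q≈ zero    = refl
        Q≈ (suc n) = *-cong (Q≈ n) (*-congʳ (+-congˡ (-‿cong (sym (^-assocʳ q r (suc n))))))
        θ≈ : ∀ n → Y.θ n ≈ θ r n
        θ≈ zero    = solve 0 (con (+ 1) := con (+ 1) :+ con (+ 2) :* con (+ 0)) refl
        θ≈ (suc n) = begin
          Y.θ n + 𝟚 * sgn (suc n) * ((q ^ r) ^ suc n) ^ suc n
            ≈⟨ +-cong (θ≈ n) (*-congˡ (trans (^-congˡ (suc n) (^-assocʳ q r (suc n)))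
                 (trans (^-assocʳ q (r ℕ.* suc n) (suc n)) (q^ (ℕ.*-assoc r (suc n) (suc n)))))) ⟩
          θ r n + 𝟚 * sgn (suc n) * q ^ (r ℕ.* (suc n ℕ.* suc n))
            ≈⟨ solve 3 (λ S σ x → con (+ 1) :+ con (+ 2) :* S :+ con (+ 2) :* σ :* x
                
                        := con (+ 1) :+ con (+ 2) :* (S :+ σ :* x))
                        refl (S r n) (sgn (suc n)) (q ^ (r ℕ.* (suc n ℕ.* suc n))) ⟩
          θ r (suc n) ∎

      P*θ*θ : ∀ n k → d ℕ.≤ n → d ℕ.≤ k → P n * θ 1 k * θ 6 k ≈ θ 2 k * θ 3 k
      P*θ*θ n k d≤n d≤k = begin
        P n * θ 1 k * θ 6 k              ≈⟨ *-cong (*-congˡ (Q≈ 1 d≤2n)) (Q≈ 6 d≤n) ⟨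
        P n * Q 1 (2 ℕ.* n) * Q 6 n      ≈⟨ P*Q*Q n ⟩
        Q 2 n * Q 3 (2 ℕ.* n)            ≈⟨ *-cong (Q≈ 2 d≤n) (Q≈ 3 d≤2n) ⟩
        θ 2 k * θ 3 k                    ∎
        where
        d≤2n = ℕ.≤-trans d≤n (ℕ.m≤m+n n _)
        Q≈ : ∀ r {m} .{{_ : ℕ.NonZero r}} → d ℕ.≤ m → Q r m ≈ θ r k
        Q≈ r d≤m = trans (Q≈θ r _ d≤m) (trans (θ-stable r _ d≤m) (sym (θ-stable r k d≤k)))

      𝟜*S*S : ∀ r t n → 𝟜 * (S r n * S t n) ≈ 𝟜 * TT r t n
      𝟜*S*S r t n = begin
        𝟜 * (S r n * S t n)  ≈⟨ *-assoc 𝟜 _ _ ⟨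
        𝟜 * S r n * S t n    ≈⟨ *-congʳ (𝟜*∑sgn n _) ⟩
        𝟜 * T r n * S t n    ≈⟨ solve 2 (λ x y → con (+ 4) :* x :* y
               := x :* (con (+ 4) :* y)) refl (T r n) (S t n) ⟩
        T r n * (𝟜 * S t n)  ≈⟨ *-congˡ (𝟜*∑sgn n _) ⟩
        T r n * (𝟜 * T t n)  ≈⟨ solve 2 (λ x y → x :* (con (+ 4) :* y)
               := con (+ 4) :* (x :* y)) refl (T r n) (T t n) ⟩
        𝟜 * (T r n * T t n)  ≈⟨ *-congˡ (*-distribʳ-∑ n (T t n) _) ⟩
        𝟜 * ∑ n (λ i → q ^ (r ℕ.* (i ℕ.* i)) * T t n)
          ≈⟨ *-congˡ (∑-cong n λ i → trans (*-distribˡ-∑ n _ _)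
               (∑-cong n λ j → sym (^-homo-* q (r ℕ.* (i ℕ.* i)) (t ℕ.* (j ℕ.* j))))) ⟩
        𝟜 * TT r t n         ∎

      𝟜*S² : ∀ r n → 𝟜 * (S r n * S r n) ≈ 𝟜 * T (2 ℕ.* r) n
      𝟜*S² r n = begin
        𝟜 * (S r n * S r n)  ≈⟨ 𝟜*∑² n _ ⟩
        𝟜 * ∑ n (λ j → (sgn j * x j) * (sgn j * x j))
          ≈⟨ *-congˡ (∑-cong n λ j → solve 2 (λ s x → (s :* x) :* (s :* x)
                 := s :* (s :* (x :* x))) refl (sgn j) (x j)) ⟩
        𝟜 * ∑ n (λ j → sgn j * (sgn j * (x j * x j)))  ≈⟨ 𝟜*∑sgn n _ ⟩
        𝟜 * ∑ n (λ j → sgn j * (x j * x j))            ≈⟨ 𝟜*∑sgn n _ ⟩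
        𝟜 * ∑ n (λ j → x j * x j)
          ≈⟨ *-congˡ (∑-cong n λ j → trans (sym (^-homo-* q (r ℕ.* (j ℕ.* j)) (r ℕ.* (j ℕ.* j)))) (q^ (double j))) ⟩
        𝟜 * T (2 ℕ.* r) n    ∎
        where
        x : ℕ → Carrier
        x j = q ^ (r ℕ.* (j ℕ.* j))
        double : ∀ j → r ℕ.* (j ℕ.* j) ℕ.+ r ℕ.* (j ℕ.* j) ≡ 2 ℕ.* r ℕ.* (j ℕ.* j)
        double j =
            ≡.trans (≡.cong (r ℕ.* (j ℕ.* j) ℕ.+_) (≡.sym (ℕ.+-identityʳ _))) (≡.sym (ℕ.*-assoc 2 r (j ℕ.* j)))

      -- The number of factors `n` and the cut-off `k` of the sums are independent: sums for four
      -- times an integer will be taken to twice the cut-off used for the integer itself. `T 2` and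
      -- `T 12` come from the squares of `S 1` and `S 6`, the `TT` from the six products of two
      -- different tails.
      P-mod-8 : ∀ n k → d ℕ.≤ n → d ℕ.≤ k →
        P n ≈ 𝟙 + 𝟚 * (S 2 k + S 3 k - S 1 k - S 6 k)
              + 𝟜 * (T 2 k + T 12 k + TT 2 3 k + TT 1 2 k + TT 2 6 k + TT 1 3 k + TT 3 6 k + TT 1 6 k)
      P-mod-8 n k d≤n d≤k = trans
        (quotient-mod-8 (P n) (S 1 k) (S 2 k) (S 3 k) (S 6 k) (P*θ*θ n k d≤n d≤k))
        (+-congˡ (𝟜*S² 1 k ⊹ 𝟜*S² 6 k ⊹ 𝟜*S*S 2 3 k ⊹ 𝟜*S*S 1 2 k
                  ⊹ 𝟜*S*S 2 6 k ⊹ 𝟜*S*S 1 3 k ⊹ 𝟜*S*S 3 6 k ⊹ 𝟜*S*S 1 6 k))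
        where
        infixl 6 _⊹_
        _⊹_ : ∀ {w x y z} → 𝟜 * w ≈ 𝟜 * x → 𝟜 * y ≈ 𝟜 * z → 𝟜 * (w + y) ≈ 𝟜 * (x + z)
        p ⊹ p′ = trans (distribˡ 𝟜 _ _) (trans (+-cong p p′) (sym (distribˡ 𝟜 _ _)))

-- Integer power series and their truncations

module PowerSeries where

  open import Data.Integer using (_+_; _*_; _-_; -_)
  open import Data.Nat using (_∸_)
  open Signed using (_∣_; divides; ∣m∣n⇒∣m+n; ∣m⇒∣-m; ∣n⇒∣m*n; ∣m⇒∣m*n)
  open ≡
  open ℤS using (solve; _:=_; _:+_; _:*_; _:-_; :-_)

  infix 4 _≡_[mod_]
  record _≡_[mod_] (x y m : ℤ) : Set where
    constructor mod
    field difference : m ∣ x - y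
  open _≡_[mod_] public

  module _ {m : ℤ} where

    ≡mod-reflexive : ∀ {x y} → x ≡ y → x ≡ y [mod m ]
    ≡mod-reflexive {x} refl = mod (divides 0ℤ (ℤ.+-inverseʳ x))

    ≡mod-refl : ∀ {x} → x ≡ x [mod m ]
    ≡mod-refl = ≡mod-reflexive refl

    ≡mod-sym : ∀ {x y} → x ≡ y [mod m ] → y ≡ x [mod m ]
    ≡mod-sym {x} {y} (mod p) = mod (subst (m ∣_) (solve 2 (λ x y → :- (x :- y) := y :- x) refl x y) (∣m⇒∣-m p))

    ≡mod-trans : ∀ {x y z} → x ≡ y [mod m ] → y ≡ z [mod m ] → x ≡ z [mod m ]
    ≡mod-trans {x} {y} {z} (mod p) (mod q) =
      mod (subst (m ∣_) (solve 3 (λ x y z → (x :- y) :+ (y :- z) := x :- z) refl x y z) (∣m∣n⇒∣m+n p q))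

    +-congᵐ : ∀ {x y u v} → x ≡ y [mod m ] → u ≡ v [mod m ] → x + u ≡ y + v [mod m ]
    +-congᵐ {x} {y} {u} {v} (mod p) (mod q) =
      mod (subst (m ∣_) (solve 4 (λ x y u v → (x :- y) :+ (u :- v)
             := (x :+ u) :- (y :+ v)) refl x y u v) (∣m∣n⇒∣m+n p q))

    *-congᵐ : ∀ {x y u v} → x ≡ y [mod m ] → u ≡ v [mod m ] → x * u ≡ y * v [mod m ]
    *-congᵐ {x} {y} {u} {v} (mod p) (mod q) =
      mod (subst (m ∣_) (solve 4 (λ x y u v → (x :- y) :* u :+ y :* (u :- v) := x :* u :- y :* v) refl x y u v)
        (∣m∣n⇒∣m+n (∣m⇒∣m*n u p) (∣n⇒∣m*n y q)))

    *-congˡᵐ : ∀ x {u v} → u ≡ v [mod m ] → x * u ≡ x * v [mod m ]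
    *-congˡᵐ x = *-congᵐ (≡mod-refl {x})

    neg-congᵐ : ∀ {x y} → x ≡ y [mod m ] → - x ≡ - y [mod m ]
    neg-congᵐ {x} {y} (mod p) = mod (subst (m ∣_) (solve 2 (λ x y → :- (x :- y)
           := :- x :- (:- y)) refl x y) (∣m⇒∣-m p))

  infixl 6 _⊕_
  _⊕_ : Series → Series → Series
  (a ⊕ b) n = a n + b n

  ⊖_ : Series → Series
  (⊖ a) n = - a n

  const : ℤ → Series
  const c zero    = c
  const c (suc _) = 0ℤ

  const-0 : ∀ n → const 0ℤ n ≡ 0ℤ
  const-0 zero    = refl
  const-0 (suc n) = refl

  tail : Series → Series
  tail a n = a (suc n)

  -- `convSum` recurses from its last index. Splitting off `a 0` instead gives a recursion along
  -- `tail`, by which the ring laws follow by induction on the coefficient.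
  ·-suc : ∀ a b n → (a · b) (suc n) ≡ a 0 * b (suc n) + (tail a · b) n
  ·-suc a b n = convSum-suc n
    where
    convSum-suc : ∀ i → convSum a b (suc n) (suc i) ≡ a 0 * b (suc n) + convSum (tail a) b n i
    convSum-suc zero    = ℤ.+-comm (a 1 * b n) (a 0 * b (suc n))
    convSum-suc (suc i) = trans (cong (_+_ (a (suc (suc i)) * b (n ∸ suc i))) (convSum-suc i))
      (solve 3 (λ x y z → x :+ (y :+ z) := y :+ (x :+ z)) refl
        (a (suc (suc i)) * b (n ∸ suc i)) (a 0 * b (suc n)) (convSum (tail a) b n i))

  ·-cong-≗ : ∀ {a a′ b b′} → a ≗ a′ → b ≗ b′ → a · b ≗ a′ · b′
  ·-cong-≗ {a} {a′} {b} {b′} p q n = go n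
    where
    go : ∀ i → convSum a b n i ≡ convSum a′ b′ n i
    go zero    = cong₂ _*_ (p 0) (q n)
    go (suc i) = cong₂ _+_ (cong₂ _*_ (p (suc i)) (q (n ∸ suc i))) (go i)

  ·-distribʳ : ∀ c a b n → ((a ⊕ b) · c) n ≡ (a · c) n + (b · c) n
  ·-distribʳ c a b zero    = ℤ.*-distribʳ-+ (c 0) (a 0) (b 0)
  ·-distribʳ c a b (suc n) = begin
    ((a ⊕ b) · c) (suc n)                                ≡⟨ ·-suc (a ⊕ b) c n ⟩
    (a 0 + b 0) * c (suc n) + ((tail a ⊕ tail b) · c) n
      ≡⟨ cong (_+_ ((a 0 + b 0) * c (suc n))) (·-distribʳ c (tail a) (tail b) n) ⟩
    (a 0 + b 0) * c (suc n) + ((tail a · c) n + (tail b · c) n)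
      ≡⟨ solve 5 (λ a b c x y → (a :+ b) :* c :+ (x :+ y) := (a :* c :+ x) :+ (b :* c :+ y)) refl
           (a 0) (b 0) (c (suc n)) ((tail a · c) n) ((tail b · c) n) ⟩
    (a 0 * c (suc n) + (tail a · c) n) + (b 0 * c (suc n) + (tail b · c) n)
      ≡⟨ sym (cong₂ _+_ (·-suc a c n) (·-suc b c n)) ⟩
    (a · c) (suc n) + (b · c) (suc n)                    ∎
    where open ≡-Reasoning

  ·-sucʳ : ∀ a b n → (a · b) (suc n) ≡ (a · tail b) n + a (suc n) * b 0
  ·-sucʳ a b zero    = ℤ.+-comm (a 1 * b 0) (a 0 * b 1)
  ·-sucʳ a b (suc n) = begin
    (a · b) (suc (suc n))                                          ≡⟨ ·-suc a b (suc n) ⟩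
    a 0 * b (suc (suc n)) + (tail a · b) (suc n)
      ≡⟨ cong (_+_ (a 0 * b (suc (suc n)))) (·-sucʳ (tail a) b n) ⟩
    a 0 * b (suc (suc n)) + ((tail a · tail b) n + a (suc (suc n)) * b 0)
      ≡⟨ sym (ℤ.+-assoc (a 0 * b (suc (suc n))) _ _) ⟩
    a 0 * b (suc (suc n)) + (tail a · tail b) n + a (suc (suc n)) * b 0
      ≡⟨ cong (_+ a (suc (suc n)) * b 0) (sym (·-suc a (tail b) n)) ⟩
    (a · tail b) (suc n) + a (suc (suc n)) * b 0                   ∎
    where open ≡-Reasoning

  ·-comm : ∀ a b → a · b ≗ b · a
  ·-comm a b zero    = ℤ.*-comm (a 0) (b 0)
  ·-comm a b (suc n) = begin
    (a · b) (suc n)                  ≡⟨ ·-suc a b n ⟩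
    a 0 * b (suc n) + (tail a · b) n ≡⟨ cong₂ _+_ (ℤ.*-comm (a 0) (b (suc n))) (·-comm (tail a) b n) ⟩
    b (suc n) * a 0 + (b · tail a) n ≡⟨ ℤ.+-comm (b (suc n) * a 0) _ ⟩
    (b · tail a) n + b (suc n) * a 0 ≡⟨ sym (·-sucʳ b a n) ⟩
    (b · a) (suc n)                  ∎
    where open ≡-Reasoning

  scale : ℤ → Series → Series
  scale c a n = c * a n

  scale-· : ∀ c a b n → (scale c a · b) n ≡ c * (a · b) n
  scale-· c a b zero    = ℤ.*-assoc c (a 0) (b 0)
  scale-· c a b (suc n) = begin
    (scale c a · b) (suc n)                            ≡⟨ ·-suc (scale c a) b n ⟩
    c * a 0 * b (suc n) + (scale c (tail a) · b) n
      ≡⟨ cong (_+_ (c * a 0 * b (suc n))) (scale-· c (tail a) b n) ⟩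
    c * a 0 * b (suc n) + c * (tail a · b) n
      ≡⟨ solve 4 (λ c a b x → c :* a :* b :+ c :* x
             := c :* (a :* b :+ x)) refl c (a 0) (b (suc n)) ((tail a · b) n) ⟩
    c * (a 0 * b (suc n) + (tail a · b) n)             ≡⟨ cong (c *_) (sym (·-suc a b n)) ⟩
    c * (a · b) (suc n)                                ∎
    where open ≡-Reasoning

  ·-assoc : ∀ a b c n → ((a · b) · c) n ≡ (a · (b · c)) n
  ·-assoc a b c zero    = ℤ.*-assoc (a 0) (b 0) (c 0)
  ·-assoc a b c (suc n) = begin
    ((a · b) · c) (suc n)                                        ≡⟨ ·-suc (a · b) c n ⟩
    a 0 * b 0 * c (suc n) + (tail (a · b) · c) n
      ≡⟨ cong (_+_ (a 0 * b 0 * c (suc n))) (·-cong-≗ {b = c} (·-suc a b) (λ _ → refl) n) ⟩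
    a 0 * b 0 * c (suc n) + ((scale (a 0) (tail b) ⊕ tail a · b) · c) n
      ≡⟨ cong (_+_ (a 0 * b 0 * c (suc n))) (·-distribʳ c (scale (a 0) (tail b)) (tail a · b) n) ⟩
    a 0 * b 0 * c (suc n) + ((scale (a 0) (tail b) · c) n + (tail a · b · c) n)
      ≡⟨ cong (_+_ (a 0 * b 0 * c (suc n))) (cong₂ _+_ (scale-· (a 0) (tail b) c n) (·-assoc (tail a) b c n)) ⟩
    a 0 * b 0 * c (suc n) + (a 0 * (tail b · c) n + (tail a · (b · c)) n)
      ≡⟨ solve 5 (λ a b c x y → a :* b :* c :+ (a :* x :+ y) := a :* (b :* c :+ x) :+ y) refl
           (a 0) (b 0) (c (suc n)) ((tail b · c) n) ((tail a · (b · c)) n) ⟩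
    a 0 * (b 0 * c (suc n) + (tail b · c) n) + (tail a · (b · c)) n
      ≡⟨ cong (λ z → a 0 * z + (tail a · (b · c)) n) (sym (·-suc b c n)) ⟩
    a 0 * (b · c) (suc n) + (tail a · (b · c)) n                 ≡⟨ sym (·-suc a (b · c) n) ⟩
    (a · (b · c)) (suc n)                                        ∎
    where open ≡-Reasoning

  0-· : ∀ a n → (const 0ℤ · a) n ≡ 0ℤ
  0-· a zero    = refl
  0-· a (suc n) = trans (·-suc (const 0ℤ) a n) (trans (ℤ.+-identityˡ _)
    (trans (·-cong-≗ {b = a} 0-tail (λ _ → refl) n) (0-· a n)))
    where
    0-tail : tail (const 0ℤ) ≗ const 0ℤ
    0-tail zero    = refl
    0-tail (suc _) = refl

  const-· : ∀ c a n → (const c · a) n ≡ c * a n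
  const-· c a zero    = refl
  const-· c a (suc n) = trans (·-suc (const c) a n) (trans (cong (_+_ (c * a (suc n)))
    (trans (·-cong-≗ {b = a} 0-tail (λ _ → refl) n) (0-· a n))) (ℤ.+-identityʳ _))
    where
    0-tail : tail (const c) ≗ const 0ℤ
    0-tail zero    = refl
    0-tail (suc _) = refl

  -- The ring (ℤ/m)[[q]] / (q^(d+1)), presented as a quotient of Series.
  module Quotient (m : ℤ) (d : ℕ) where

    infix 4 _≈_
    record _≈_ (a b : Series) : Set where
      constructor coeffwise
      field coeff : ∀ {k} → k ≤ d → a k ≡ b k [mod m ]
    open _≈_ public

    exact : ∀ {a b} → a ≗ b → a ≈ b
    exact a≗b = coeffwise λ {k} _ → ≡mod-reflexive (a≗b k)

    ·-cong : ∀ {a a′ b b′} → a ≈ a′ → b ≈ b′ → a · b ≈ a′ · b′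
    ·-cong {a} {a′} {b} {b′} p q = coeffwise λ k≤d → go k≤d _ ℕ.≤-refl
      where
      go : ∀ {k} → k ≤ d → ∀ i → i ≤ k → convSum a b k i ≡ convSum a′ b′ k i [mod m ]
      go k≤d zero    _   = *-congᵐ (coeff p z≤n) (coeff q k≤d)
      go {k} k≤d (suc i) i<k = +-congᵐ
        (*-congᵐ (coeff p (ℕ.≤-trans i<k k≤d)) (coeff q (ℕ.≤-trans (ℕ.m∸n≤m k (suc i)) k≤d)))
        (go k≤d i (ℕ.<⇒≤ i<k))

    ring : CommutativeRing 0ℓ 0ℓ
    ring = record
      { Carrier = Series ; _≈_ = _≈_ ; _+_ = _⊕_ ; _*_ = _·_ ; -_ = ⊖_ ; 0# = const 0ℤ ; 1# = const 1ℤ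
      ; isCommutativeRing = record
        { isRing = record
          { +-isAbelianGroup = record
            { isGroup = record
              { isMonoid = record
                { isSemigroup = record
                  { isMagma = record
                    { isEquivalence = record
                      { refl  = exact λ _ → refl
                      ; sym   = λ p → coeffwise λ k≤d → ≡mod-sym (coeff p k≤d)
                      ; trans = λ p q → coeffwise λ k≤d → ≡mod-trans (coeff p k≤d) (coeff q k≤d) }
                    ; ∙-cong = λ p q → coeffwise λ k≤d → +-congᵐ (coeff p k≤d) (coeff q k≤d) }
                  ; assoc = λ a b c → exact λ n → ℤ.+-assoc (a n) (b n) (c n) }
                ; identity = (λ a → exact λ n → trans (cong (_+ a n) (const-0 n)) (ℤ.+-identityˡ (a n)))
                           , (λ a → exact λ n → trans (cong (_+_ (a n)) (const-0 n)) (ℤ.+-identityʳ (a n))) }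
              ; inverse = (λ a → exact λ n → trans (ℤ.+-inverseˡ (a n)) (sym (const-0 n)))
                        , (λ a → exact λ n → trans (ℤ.+-inverseʳ (a n)) (sym (const-0 n)))
              ; ⁻¹-cong = λ p → coeffwise λ k≤d → neg-congᵐ (coeff p k≤d) }
            ; comm = λ a b → exact λ n → ℤ.+-comm (a n) (b n) }
          ; *-cong = ·-cong
          ; *-assoc = λ a b c → exact (·-assoc a b c)
          ; *-identity = (λ a → exact (1-· a)) , (λ a → exact λ n → trans (·-comm a (const 1ℤ) n) (1-· a n))
          ; distrib = (λ c a b → exact λ n → trans (·-comm c (a ⊕ b) n)
                        (trans (·-distribʳ c a b n) (cong₂ _+_ (·-comm a c n) (·-comm b c n))))
                    , (λ c a b → exact (·-distribʳ c a b)) }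
        ; *-comm = λ a b → exact (·-comm a b) } }
      where
      1-· : ∀ a n → (const 1ℤ · a) n ≡ a n
      1-· a n = trans (const-· 1ℤ a n) (ℤ.*-identityˡ (a n))

    const-hom : ℤ.+-*-rawRing -Raw-AlmostCommutative⟶ fromCommutativeRing ring
    const-hom = record
      { ⟦_⟧    = const
      ; +-homo = λ x y → exact λ { zero → refl ; (suc n) → refl }
      ; *-homo = λ x y → exact λ n → sym (trans (const-· x (const y) n) (const* x y n))
      ; -‿homo = λ x → exact λ { zero → refl ; (suc n) → refl }
      ; 0-homo = exact λ _ → refl
      ; 1-homo = exact λ _ → refl }
      where
      const* : ∀ x y n → x * const y n ≡ const (x * y) n
      const* x y zero    = refl
      const* x y (suc n) = ℤ.*-zeroʳ x

  shift : Series → Series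
  shift a zero    = 0ℤ
  shift a (suc n) = a n

  shift-· : ∀ a b → shift a · b ≗ shift (a · b)
  shift-· a b zero    = refl
  shift-· a b (suc n) = trans (·-suc (shift a) b n) (ℤ.+-identityˡ _)

  mono : ℕ → Series
  mono zero    = const 1ℤ
  mono (suc k) = shift (mono k)

  mono-vanishes : ∀ {k n} → n ℕ.< k → mono k n ≡ 0ℤ
  mono-vanishes {suc k} {zero}  _       = refl
  mono-vanishes {suc k} {suc n} (s≤s p) = mono-vanishes p

  mono-·-< : ∀ {k n} a → n ℕ.< k → (mono k · a) n ≡ 0ℤ
  mono-·-< {suc k} {zero}  a _       = refl
  mono-·-< {suc k} {suc n} a (s≤s p) = trans (shift-· (mono k) a (suc n)) (mono-·-< a p)

  mono-·-+ : ∀ k a n → (mono k · a) (k ℕ.+ n) ≡ a n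
  mono-·-+ zero    a n = trans (const-· 1ℤ a n) (ℤ.*-identityˡ (a n))
  mono-·-+ (suc k) a n = trans (shift-· (mono k) a (suc (k ℕ.+ n))) (mono-·-+ k a n)

  binom-expand : ∀ ε m .{{_ : ℕ.NonZero m}} → binom ε m ≗ const 1ℤ ⊕ scale ε (mono m)
  binom-expand ε (suc m) zero    = sym (cong (_+_ 1ℤ) (ℤ.*-zeroʳ ε))
  binom-expand ε (suc m) (suc n) = trans (go m n) (sym (ℤ.+-identityˡ _))
    where
    go : ∀ m n → (if n ℕ.≡ᵇ m then ε else 0ℤ) ≡ ε * mono m n
    go zero    zero    = sym (ℤ.*-identityʳ ε)
    go zero    (suc n) = sym (ℤ.*-zeroʳ ε)
    go (suc m) zero    = sym (ℤ.*-zeroʳ ε)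
    go (suc m) (suc n) = go m n

  geom-periodic : ∀ ε m .{{_ : ℕ.NonZero m}} n → geom ε m (m ℕ.+ n) ≡ ε * geom ε m n
  geom-periodic ε (suc m) n = begin
    (if (suc m ℕ.+ n) ℕ.% suc m ℕ.≡ᵇ 0 then sgnPow ε ((suc m ℕ.+ n) ℕ./ suc m) else 0ℤ)
      ≡⟨ cong₂ (λ x y → if x ℕ.≡ᵇ 0 then sgnPow ε y else 0ℤ) %-periodic /-periodic ⟩
    (if n ℕ.% suc m ℕ.≡ᵇ 0 then ε * sgnPow ε (n ℕ./ suc m) else 0ℤ)
      ≡⟨ if-* (n ℕ.% suc m ℕ.≡ᵇ 0) ⟩
    ε * geom ε (suc m) n ∎
    where
    open ≡-Reasoning
    %-periodic : (suc m ℕ.+ n) ℕ.% suc m ≡ n ℕ.% suc m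
    %-periodic = trans (ℕ.%-congˡ (ℕ.+-comm (suc m) n)) (ℕ.[m+n]%n≡m%n n (suc m))
    /-periodic : (suc m ℕ.+ n) ℕ./ suc m ≡ suc (n ℕ./ suc m)
    /-periodic =
        trans (ℕ.m/n≡1+[m∸n]/n (ℕ.m≤m+n (suc m) n)) (cong (λ k → suc (k ℕ./ suc m)) (ℕ.m+n∸m≡n (suc m) n))
    if-* : ∀ c {x} → (if c then ε * x else 0ℤ) ≡ ε * (if c then x else 0ℤ)
    if-* true  = refl
    if-* false = sym (ℤ.*-zeroʳ ε)

  -- The functional equation g = 1 + ε q^m g. Below degree m only the constant term is nonzero; from
  -- m on it is `geom-periodic`.
  geom-expand : ∀ ε m .{{_ : ℕ.NonZero m}} → geom ε m ≗ const 1ℤ ⊕ scale ε (mono m · geom ε m)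
  geom-expand ε (suc m) zero    = sym (cong (_+_ 1ℤ) (ℤ.*-zeroʳ ε))
  geom-expand ε (suc m) (suc n) with suc n ℕ.<? suc m
  ... | yes n<m = trans (cong (λ x → if x ℕ.≡ᵇ 0 then sgnPow ε (suc n ℕ./ suc m) else 0ℤ) (ℕ.m<n⇒m%n≡m n<m))
                    (sym (trans (ℤ.+-identityˡ _) (trans (cong (ε *_) (mono-·-< (geom ε (suc m)) n<m)) (ℤ.*-zeroʳ ε))))
  ... | no  n≮m = begin
    geom ε (suc m) (suc n)           ≡⟨ cong (geom ε (suc m)) m+k≡n ⟨
    geom ε (suc m) (suc m ℕ.+ k)     ≡⟨ geom-periodic ε (suc m) k ⟩
    ε * geom ε (suc m) k             ≡⟨ cong (ε *_) (mono-·-+ (suc m) (geom ε (suc m)) k) ⟨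
    ε * (mono (suc m) · geom ε (suc m)) (suc m ℕ.+ k)
      ≡⟨ cong (λ i → ε * (mono (suc m) · geom ε (suc m)) i) m+k≡n ⟩
    ε * (mono (suc m) · geom ε (suc m)) (suc n)        ≡⟨ sym (ℤ.+-identityˡ _) ⟩
    0ℤ + ε * (mono (suc m) · geom ε (suc m)) (suc n)   ∎
    where
    open ≡-Reasoning
    k = suc n ∸ suc m
    m+k≡n : suc m ℕ.+ k ≡ suc n
    m+k≡n = ℕ.m+[n∸m]≡n (ℕ.≮⇒≥ n≮m)

  geom-inverse : ∀ ε m .{{_ : ℕ.NonZero m}} → (const 1ℤ ⊕ scale (- ε) (mono m)) · geom ε m ≗ const 1ℤ
  geom-inverse ε m n = begin
    ((const 1ℤ ⊕ scale (- ε) (mono m)) · g) n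
      ≡⟨ ·-distribʳ g (const 1ℤ) (scale (- ε) (mono m)) n ⟩
    (const 1ℤ · g) n + (scale (- ε) (mono m) · g) n
      ≡⟨ cong₂ _+_ (trans (const-· 1ℤ g n) (ℤ.*-identityˡ (g n))) (scale-· (- ε) (mono m) g n) ⟩
    g n + - ε * (mono m · g) n
      ≡⟨ cong (_+ - ε * (mono m · g) n) (geom-expand ε m n) ⟩
    const 1ℤ n + ε * (mono m · g) n + - ε * (mono m · g) n
      ≡⟨ solve 3 (λ c e x → c :+ e :* x :+ :- e :* x := c) refl (const 1ℤ n) ε ((mono m · g) n) ⟩
    const 1ℤ n ∎
    where
    open ≡-Reasoning
    g = geom ε m

  -- Coefficients as counts of representations

  χ : {A : Set} → Dec A → ℤ
  χ (yes _) = 1ℤ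
  χ (no _)  = 0ℤ

  ∑ : ℕ → (ℕ → ℤ) → ℤ
  ∑ zero    f = 0ℤ
  ∑ (suc n) f = ∑ n f + f (suc n)

  ∑-congᵐ : ∀ {m} n {f g} → (∀ j → f j ≡ g j [mod m ]) → ∑ n f ≡ ∑ n g [mod m ]
  ∑-congᵐ zero    f≡g = ≡mod-refl
  ∑-congᵐ (suc n) f≡g = +-congᵐ (∑-congᵐ n f≡g) (f≡g (suc n))

  signed unsigned : ℕ → ℕ → ℕ → ℤ
  signed   r n k = ∑ k λ j → sgnPow -1ℤ j * χ (r ℕ.* (j ℕ.* j) ℕ.≟ n)
  unsigned r n k = ∑ k λ j → χ (r ℕ.* (j ℕ.* j) ℕ.≟ n)

  pairs : ℕ → ℕ → ℕ → ℕ → ℤ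
  pairs r t n k = ∑ k λ i → ∑ k λ j → χ (r ℕ.* (i ℕ.* i) ℕ.+ t ℕ.* (j ℕ.* j) ℕ.≟ n)

  mono-χ : ∀ k n → mono k n ≡ χ (k ℕ.≟ n)
  mono-χ k n with k ℕ.≟ n
  ... | yes refl = diagonal k
    where
    diagonal : ∀ k → mono k k ≡ 1ℤ
    diagonal zero    = refl
    diagonal (suc k) = diagonal k
  ... | no  k≢n  = off-diagonal k n k≢n
    where
    off-diagonal : ∀ k n → k ≢ n → mono k n ≡ 0ℤ
    off-diagonal zero    zero    k≢n = contradiction refl k≢n
    off-diagonal zero    (suc n) k≢n = refl
    off-diagonal (suc k) zero    k≢n = refl
    off-diagonal (suc k) (suc n) k≢n = off-diagonal k n (λ k≡n → k≢n (cong suc k≡n))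

  module _ (n : ℕ) where

    open Quotient (+ 8) n
    open CommutativeRing ring using (semiring; *-cong; *-congˡ; *-congʳ; +-congˡ; -‿cong)
      renaming (refl to ≈-refl; sym to ≈-sym; trans to ≈-trans)
    open Exp semiring using (_^_)
    private module R = Ring ring const-hom

    private
      q : Series
      q = mono 1

    q^≈mono : ∀ k → q ^ k ≈ mono k
    q^≈mono zero    = ≈-refl
    q^≈mono (suc k) = ≈-trans (*-congˡ {q} (q^≈mono k)) (exact λ i →
      trans (shift-· (const 1ℤ) (mono k) i) (shift-cong (λ i → trans (const-· 1ℤ (mono k) i) (ℤ.*-identityˡ _)) i))
      where
      shift-cong : ∀ {a b : Series} → a ≗ b → shift a ≗ shift b
      shift-cong a≗b zero    = refl
      shift-cong a≗b (suc i) = a≗b i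

    q^≈0 : ∀ k → n ℕ.< k → q ^ k ≈ const 0ℤ
    q^≈0 k n<k = ≈-trans (q^≈mono k) (coeffwise λ {i} i≤n →
      ≡mod-reflexive (trans (mono-vanishes (ℕ.≤-<-trans i≤n n<k)) (sym (const-0 i))))

    8≈0 : const (+ 8) ≈ const (+ 0)
    8≈0 = coeffwise λ { {zero} _ → mod (divides 1ℤ refl) ; {suc i} _ → ≡mod-refl }

    1+q^ : ∀ m → scale 1ℤ (mono m) ≈ q ^ m
    1+q^ m = ≈-trans (exact λ i → ℤ.*-identityˡ _) (≈-sym (q^≈mono m))

    1-q^ : ∀ m → scale -1ℤ (mono m) ≈ ⊖ (q ^ m)
    1-q^ m = ≈-trans (exact λ i → ℤ.-1*i≡-i _) (-‿cong (≈-sym (q^≈mono m)))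

    module P = R.Product q (geom -1ℤ) (geom 1ℤ)
      (λ m → ≈-trans (*-congʳ {geom -1ℤ m} (+-congˡ {const 1ℤ} (≈-sym (1+q^ m)))) (exact (geom-inverse -1ℤ m)))
      (λ m → ≈-trans (*-congʳ {geom 1ℤ m} (+-congˡ {const 1ℤ} (≈-sym (1-q^ m)))) (exact (geom-inverse 1ℤ m)))

    partialProd≈P : ∀ k → partialProd k ≈ P.P k
    partialProd≈P zero    = exact λ { zero → refl ; (suc i) → refl }
    partialProd≈P (suc k) = *-cong {partialProd k} {P.P k} (partialProd≈P k)
      (*-congʳ {geom 1ℤ m} (*-congʳ {geom -1ℤ (3 ℕ.* m)} (*-cong
        (≈-trans (exact (binom-expand 1ℤ m)) (+-congˡ {const 1ℤ} (1+q^ m)))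
        (≈-trans (exact (binom-expand -1ℤ (3 ℕ.* m))) (+-congˡ {const 1ℤ} (1-q^ (3 ℕ.* m)))))))
      where m = suc (2 ℕ.* k)

    q^-coeff : ∀ k → (q ^ k) n ≡ χ (k ℕ.≟ n) [mod + 8 ]
    q^-coeff k = ≡mod-trans (coeff (q^≈mono k) ℕ.≤-refl) (≡mod-reflexive (mono-χ k n))

    ∑-coeff : ∀ k f → R.∑ k f n ≡ ∑ k (λ j → f j n)
    ∑-coeff zero    f = const-0 n
    ∑-coeff (suc k) f = cong (_+ f (suc k) n) (∑-coeff k f)

    sgn≗ : ∀ j → R.sgn j ≗ const (sgnPow -1ℤ j)
    sgn≗ zero    i       = refl
    sgn≗ (suc j) zero    = trans (cong -_ (sgn≗ j 0)) (sym (ℤ.-1*i≡-i _))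
    sgn≗ (suc j) (suc i) = cong -_ (sgn≗ j (suc i))

    S-coeff : ∀ r k → P.S r k n ≡ signed r n k [mod + 8 ]
    S-coeff r k = ≡mod-trans (≡mod-reflexive (∑-coeff k _)) (∑-congᵐ k λ j →
      ≡mod-trans (≡mod-reflexive (trans (·-cong-≗ {b = q ^ (r ℕ.* (j ℕ.* j))} (sgn≗ j) (λ _ → refl) n)
                                        (const-· (sgnPow -1ℤ j) (q ^ (r ℕ.* (j ℕ.* j))) n)))
                 (*-congˡᵐ (sgnPow -1ℤ j) (q^-coeff (r ℕ.* (j ℕ.* j)))))

    T-coeff : ∀ r k → P.T r k n ≡ unsigned r n k [mod + 8 ]
    T-coeff r k = ≡mod-trans (≡mod-reflexive (∑-coeff k _)) (∑-congᵐ k λ j → q^-coeff (r ℕ.* (j ℕ.* j)))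

    TT-coeff : ∀ r t k → P.TT r t k n ≡ pairs r t n k [mod + 8 ]
    TT-coeff r t k = ≡mod-trans (≡mod-reflexive (∑-coeff k _)) (∑-congᵐ k λ i →
      ≡mod-trans (≡mod-reflexive (∑-coeff k _)) (∑-congᵐ k λ j → q^-coeff (r ℕ.* (i ℕ.* i) ℕ.+ t ℕ.* (j ℕ.* j))))

    S3bar-mod-8 : ∀ k → n ≤ k → S3bar n ≡
      const 1ℤ n + + 2 * (signed 2 n k + signed 3 n k - signed 1 n k - signed 6 n k)
      + + 4 * (unsigned 2 n k + unsigned 12 n k + pairs 2 3 n k + pairs 1 2 n k
               + pairs 2 6 n k + pairs 1 3 n k + pairs 3 6 n k + pairs 1 6 n k) [mod + 8 ]
    S3bar-mod-8 k n≤k = ≡mod-trans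
      -- `suc n` factors are those in the definition of `S3bar n`, and the truncation after degree
      -- `n` still retains the coefficient at `n`.
      (coeff (≈-trans (partialProd≈P (suc n)) (P.Truncated.P-mod-8 n q^≈0 8≈0 (suc n) k (ℕ.n≤1+n n) n≤k)) ℕ.≤-refl)
      (+-congᵐ (+-congᵐ (≡mod-refl {x = const 1ℤ n})
        (≡mod-trans (≡mod-reflexive (const-· (+ 2) (P.S 2 k ⊕ P.S 3 k ⊕ (⊖ P.S 1 k) ⊕ (⊖ P.S 6 k)) n)) (*-congˡᵐ (+ 2)
          (+-congᵐ (+-congᵐ (+-congᵐ (S-coeff 2 k) (S-coeff 3 k)) (neg-congᵐ (S-coeff 1 k))) (neg-congᵐ (S-coeff 6 k))))))
        (≡mod-trans (≡mod-reflexive (const-· (+ 4) (P.T 2 k ⊕ P.T 12 k ⊕ P.TT 2 3 k ⊕ P.TT 1 2 k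
          ⊕ P.TT 2 6 k ⊕ P.TT 1 3 k ⊕ P.TT 3 6 k ⊕ P.TT 1 6 k) n)) (*-congˡᵐ (+ 4)
          (+-congᵐ (+-congᵐ (+-congᵐ (+-congᵐ (+-congᵐ (+-congᵐ (+-congᵐ (T-coeff 2 k) (T-coeff 12 k))
            (TT-coeff 2 3 k)) (TT-coeff 1 2 k)) (TT-coeff 2 6 k)) (TT-coeff 1 3 k)) (TT-coeff 3 6 k)) (TT-coeff 1 6 k)))))

-- Counting representations and congruence obstructions

module Representations where

  open import Data.Integer using (_+_; _*_)
  open ℕᵈ using () renaming (_∣_ to _∣ⁿ_; _∣?_ to _∣ⁿ?_)
  open Signed using (divides)
  open ≡
  open PowerSeries
  open ℤS using (solve; _:=_; _:+_; _:*_; _:-_; con)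

  χ-yes : ∀ {A : Set} (a : Dec A) → A → χ a ≡ 1ℤ
  χ-yes (yes _) _ = refl
  χ-yes (no ¬a) a = contradiction a ¬a

  χ-no : ∀ {A : Set} (a : Dec A) → ¬ A → χ a ≡ 0ℤ
  χ-no (yes a) ¬a = contradiction a ¬a
  χ-no (no _)  _  = refl

  χ-cong : ∀ {A B : Set} (a : Dec A) (b : Dec B) → (A → B) → (B → A) → χ a ≡ χ b
  χ-cong (yes a) b f g = sym (χ-yes b (f a))
  χ-cong (no ¬a) b f g = sym (χ-no b (¬a ∘ g))

  ∑-cong : ∀ n {f g} → (∀ j → 1 ≤ j → j ≤ n → f j ≡ g j) → ∑ n f ≡ ∑ n g
  ∑-cong zero    f≡g = refl
  ∑-cong (suc n) f≡g =
      cong₂ _+_ (∑-cong n λ j 1≤j j≤n → f≡g j 1≤j (ℕ.m≤n⇒m≤1+n j≤n)) (f≡g (suc n) (s≤s z≤n) ℕ.≤-refl)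

  ∑-zero : ∀ n {f} → (∀ j → 1 ≤ j → j ≤ n → f j ≡ 0ℤ) → ∑ n f ≡ 0ℤ
  ∑-zero n f≡0 = trans (∑-cong n f≡0) (zeros n)
    where
    zeros : ∀ n → ∑ n (λ _ → 0ℤ) ≡ 0ℤ
    zeros zero    = refl
    zeros (suc n) = trans (ℤ.+-identityʳ _) (zeros n)

  ∑-+ : ∀ n f g → ∑ n (λ j → f j + g j) ≡ ∑ n f + ∑ n g
  ∑-+ zero    f g = refl
  ∑-+ (suc n) f g = trans (cong (_+ (f (suc n) + g (suc n))) (∑-+ n f g))
    (solve 4 (λ a b c d → (a :+ b) :+ (c :+ d)
           := (a :+ c) :+ (b :+ d)) refl (∑ n f) (∑ n g) (f (suc n)) (g (suc n)))

  *-distribˡ-∑ : ∀ n c f → c * ∑ n f ≡ ∑ n (λ j → c * f j)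
  *-distribˡ-∑ zero    c f = ℤ.*-zeroʳ c
  *-distribˡ-∑ (suc n) c f = trans (ℤ.*-distribˡ-+ c _ _) (cong (_+ c * f (suc n)) (*-distribˡ-∑ n c f))

  ∑-swap : ∀ m n (f : ℕ → ℕ → ℤ) → ∑ m (λ i → ∑ n (f i)) ≡ ∑ n (λ j → ∑ m (λ i → f i j))
  ∑-swap zero    n f = sym (∑-zero n λ _ _ _ → refl)
  ∑-swap (suc m) n f =
      trans (cong (_+ ∑ n (f (suc m))) (∑-swap m n f)) (sym (∑-+ n (λ j → ∑ m (λ i → f i j)) (f (suc m))))

  ∑-shrink : ∀ e n f → (∀ j → n < j → f j ≡ 0ℤ) → ∑ (e ℕ.+ n) f ≡ ∑ n f
  ∑-shrink zero    n f f≡0 = refl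
  ∑-shrink (suc e) n f f≡0 =
      trans (cong₂ _+_ (∑-shrink e n f f≡0) (f≡0 (suc (e ℕ.+ n)) (s≤s (ℕ.m≤n+m n e)))) (ℤ.+-identityʳ _)

  ∑-stable : ∀ {n k} f → n ≤ k → (∀ j → n < j → f j ≡ 0ℤ) → ∑ k f ≡ ∑ n f
  ∑-stable {n} {k} f n≤k f≡0 = trans (cong (λ k → ∑ k f) (sym (ℕ.m∸n+n≡m n≤k))) (∑-shrink (k ℕ.∸ n) n f f≡0)

  ∑-single : ∀ n x f → 1 ≤ x → x ≤ n → (∀ j → j ≢ x → f j ≡ 0ℤ) → ∑ n f ≡ f x
  ∑-single zero    zero    f () _ _
  ∑-single zero    (suc x) f _ () _
  ∑-single (suc n) x f 1≤x x≤n f≡0 with x ℕ.≟ suc n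
  ... | yes refl = trans (cong (_+ f (suc n)) (∑-zero n λ j _ j≤n → f≡0 j (ℕ.<⇒≢ (s≤s j≤n)))) (ℤ.+-identityˡ _)
  ... | no x≢n  =
      trans (cong₂ _+_ (∑-single n x f 1≤x (ℕ.≤-pred (ℕ.≤∧≢⇒< x≤n x≢n)) f≡0) (f≡0 (suc n) (≢-sym x≢n))) (ℤ.+-identityʳ _)

  ∑-multiples : ∀ d .{{_ : ℕ.NonZero d}} n f → (∀ j → ¬ d ∣ⁿ j → f j ≡ 0ℤ) → ∑ (d ℕ.* n) f ≡ ∑ n (λ j → f (d ℕ.* j))
  ∑-multiples d zero f f≡0 = cong (λ k → ∑ k f) (ℕ.*-zeroʳ d)
  ∑-multiples (suc d) (suc n) f f≡0 = begin
    ∑ (suc d ℕ.* suc n) f                              ≡⟨ cong (λ k → ∑ k f) (ℕ.*-suc (suc d) n) ⟩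
    ∑ (d ℕ.+ suc d ℕ.* n) f + f (suc d ℕ.+ suc d ℕ.* n)
      ≡⟨ cong₂ _+_ (skip d ℕ.≤-refl) (cong f (sym (ℕ.*-suc (suc d) n))) ⟩
    ∑ (suc d ℕ.* n) f + f (suc d ℕ.* suc n)
      ≡⟨ cong (_+ f (suc d ℕ.* suc n)) (∑-multiples (suc d) n f f≡0) ⟩
    ∑ (suc n) (λ j → f (suc d ℕ.* j))                  ∎
    where
    open ≡-Reasoning
    skip : ∀ i → i ≤ d → ∑ (i ℕ.+ suc d ℕ.* n) f ≡ ∑ (suc d ℕ.* n) f
    skip zero    _   = refl
    skip (suc i) i<d = trans (cong₂ _+_ (skip i (ℕ.<⇒≤ i<d)) (f≡0 _ λ d∣ →
      ℕ.<⇒≱ (s≤s i<d) (ℕᵈ.∣⇒≤ (ℕᵈ.∣m+n∣m⇒∣n (subst (suc d ∣ⁿ_) (ℕ.+-comm (suc i) _) d∣) (ℕᵈ.m∣m*n n))))) (ℤ.+-identityʳ _)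

  ∑∑-even : ∀ n (f : ℕ → ℕ → ℤ) → (∀ i j → ¬ (2 ∣ⁿ i × 2 ∣ⁿ j) → f i j ≡ 0ℤ) →
    ∑ (2 ℕ.* n) (λ i → ∑ (2 ℕ.* n) (f i)) ≡ ∑ n (λ i → ∑ n (λ j → f (2 ℕ.* i) (2 ℕ.* j)))
  ∑∑-even n f f≡0 = trans
    (∑-multiples 2 n _ λ i 2∤i → ∑-zero (2 ℕ.* n) λ j _ _ → f≡0 i j (2∤i ∘ proj₁))
    (∑-cong n λ i _ _ → ∑-multiples 2 n (f (2 ℕ.* i)) λ j 2∤j → f≡0 (2 ℕ.* i) j (2∤j ∘ proj₂))

  -- Off the diagonal the equal terms at (i, j) and (j, i) pair up.
  ∑-symmetric : ∀ n (f : ℕ → ℕ → ℤ) → (∀ i j → f i j ≡ f j i) → ∑ n (λ i → ∑ n (f i)) ≡ ∑ n (λ i → f i i) [mod + 2 ]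
  ∑-symmetric zero    f f-sym = ≡mod-refl
  ∑-symmetric (suc n) f f-sym = ≡mod-trans (≡mod-reflexive split) (≡mod-trans
    (+-congᵐ (∑-symmetric n f f-sym) (≡mod-refl {x = + 2 * b + c})) (mod (divides b
      (solve 3 (λ a b c → (a :+ (con (+ 2) :* b :+ c)) :- (a :+ c)
             := b :* con (+ 2)) refl (∑ n (λ i → f i i)) b c))))
    where
    b = ∑ n (f (suc n))
    c = f (suc n) (suc n)
    split : ∑ n (λ i → ∑ n (f i) + f i (suc n)) + (b + c) ≡ ∑ n (λ i → ∑ n (f i)) + (+ 2 * b + c)
    split = trans (cong (_+ (b + c)) (trans (∑-+ n (λ i → ∑ n (f i)) (λ i → f i (suc n)))
                                       (cong (_+_ (∑ n (λ i → ∑ n (f i)))) (∑-cong n λ i _ _ → f-sym i (suc n)))))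
      (solve 3 (λ a b c → (a :+ b) :+ (b :+ c) := a :+ (con (+ 2) :* b :+ c)) refl (∑ n (λ i → ∑ n (f i))) b c)

  -- For the indicator of the graph of an involution on pairs, this says that points and fixed
  -- points agree in number modulo 2. Exchanging the middle sums brings `i` and `x` together;
  -- `∑-symmetric` is applied to them and then, on i = x, to `j` and `y`.
  ∑∑-symmetric : ∀ n (f : ℕ → ℕ → ℕ → ℕ → ℤ) → (∀ i j x y → f i j x y ≡ f x y i j) →
    ∑ n (λ i → ∑ n (λ j → ∑ n (λ x → ∑ n (λ y → f i j x y)))) ≡ ∑ n (λ i → ∑ n (λ j → f i j i j)) [mod + 2 ]
  ∑∑-symmetric n f f-sym = ≡mod-trans
    (≡mod-reflexive (∑-cong n λ i _ _ → ∑-swap n n (λ j x → ∑ n (f i j x))))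
    (≡mod-trans (∑-symmetric n h h-sym) (∑-congᵐ n λ i → ∑-symmetric n (λ j → f i j i) (λ j y → f-sym i j i y)))
    where
    h : ℕ → ℕ → ℤ
    h i x = ∑ n (λ j → ∑ n (f i j x))
    h-sym : ∀ i x → h i x ≡ h x i
    h-sym i x = trans (∑-swap n n (λ j → f i j x)) (∑-cong n λ y _ _ → ∑-cong n λ j _ _ → f-sym i j x y)

  form-% : ∀ m .{{_ : ℕ.NonZero m}} r t i j →
    (r ℕ.* (i ℕ.* i) ℕ.+ t ℕ.* (j ℕ.* j)) ℕ.% m
    ≡ (r ℕ.* ((i ℕ.% m) ℕ.* (i ℕ.% m)) ℕ.+ t ℕ.* ((j ℕ.% m) ℕ.* (j ℕ.% m))) ℕ.% m
  form-% m r t i j = trans (ℕ.%-distribˡ-+ (r ℕ.* (i ℕ.* i)) (t ℕ.* (j ℕ.* j)) m)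
    (trans (cong₂ (λ x y → (x ℕ.+ y) ℕ.% m) (square-% r i) (square-% t j)) (sym (ℕ.%-distribˡ-+ (r ℕ.* (a ℕ.* a)) (t ℕ.* (b ℕ.* b)) m)))
    where
    a = i ℕ.% m
    b = j ℕ.% m
    square-% : ∀ r i → (r ℕ.* (i ℕ.* i)) ℕ.% m ≡ (r ℕ.* ((i ℕ.% m) ℕ.* (i ℕ.% m))) ℕ.% m
    square-% r i =
        trans (ℕ.%-distribˡ-* r (i ℕ.* i) m) (trans (cong (λ x → ((r ℕ.% m) ℕ.* x) ℕ.% m) (ℕ.%-distribˡ-* i i m))
      (sym (ℕ.%-distribˡ-* r ((i ℕ.% m) ℕ.* (i ℕ.% m)) m)))

  -- The modulus is suc m.
  Residues : (ℕ → ℕ → Set) → ℕ → ℕ → ℕ → ℕ → Set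
  Residues P r t m c = ∀ {a} → a < suc m → ∀ {b} → b < suc m →
    (r ℕ.* (a ℕ.* a) ℕ.+ t ℕ.* (b ℕ.* b)) ℕ.% suc m ≡ c → P a b

  residues? : ∀ {P : ℕ → ℕ → Set} → (∀ a b → Dec (P a b)) → ∀ r t m c → Dec (Residues P r t m c)
  residues? P? r t m c = ℕ.allUpTo? (λ a → ℕ.allUpTo? (λ b → (_ ℕ.≟ c) →-dec P? a b) (suc m)) (suc m)

  -- The implicit argument is solved by evaluating the decision over all pairs of residues, so each
  -- concrete use is a finite computation.
  by-residues : ∀ {P : ℕ → ℕ → Set} (P? : ∀ a b → Dec (P a b)) r t m c {_ : True (residues? P? r t m c)} →
    ∀ i j n → n ℕ.% suc m ≡ c → r ℕ.* (i ℕ.* i) ℕ.+ t ℕ.* (j ℕ.* j) ≡ n → P (i ℕ.% suc m) (j ℕ.% suc m)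
  by-residues P? r t m c {ok} i j n n%m eq = toWitness ok (ℕ.m%n<n i (suc m)) (ℕ.m%n<n j (suc m))
    (trans (sym (form-% (suc m) r t i j)) (trans (cong (ℕ._% suc m) eq) n%m))

  none? : (a b : ℕ) → Dec ⊥
  none? _ _ = no λ ()

  insoluble : ∀ r t m c {_ : True (residues? none? r t m c)} →
    ∀ {n} → n ℕ.% suc m ≡ c → ∀ i j → r ℕ.* (i ℕ.* i) ℕ.+ t ℕ.* (j ℕ.* j) ≢ n
  insoluble r t m c {ok} {n} n%m i j = by-residues none? r t m c {ok} i j n n%m

  BothEven SameParity : ℕ → ℕ → Set
  BothEven   i j = 2 ∣ⁿ i × 2 ∣ⁿ j
  SameParity i j = BothEven i j ⊎ (¬ 2 ∣ⁿ i × ¬ 2 ∣ⁿ j)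

  bothEven? : ∀ i j → Dec (BothEven i j)
  bothEven? i j = 2 ∣ⁿ? i ×-dec 2 ∣ⁿ? j

  sameParity? : ∀ i j → Dec (SameParity i j)
  sameParity? i j = bothEven? i j ⊎-dec (¬? (2 ∣ⁿ? i) ×-dec ¬? (2 ∣ⁿ? j))

  both-even : ∀ r t m c {_ : True (residues? bothEven? r t m c)} → 2 ∣ⁿ suc m →
    ∀ {n} → n ℕ.% suc m ≡ c → ∀ i j → r ℕ.* (i ℕ.* i) ℕ.+ t ℕ.* (j ℕ.* j) ≡ n → BothEven i j
  both-even r t m c {ok} 2∣m {n} n%m i j eq with by-residues bothEven? r t m c {ok} i j n n%m eq
  ... | 2∣i , 2∣j = ℕᵈ.∣n∣m%n⇒∣m 2∣m 2∣i , ℕᵈ.∣n∣m%n⇒∣m 2∣m 2∣j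

  same-parity : ∀ r t m c {_ : True (residues? sameParity? r t m c)} → 2 ∣ⁿ suc m →
    ∀ {n} → n ℕ.% suc m ≡ c → ∀ i j → r ℕ.* (i ℕ.* i) ℕ.+ t ℕ.* (j ℕ.* j) ≡ n → SameParity i j
  same-parity r t m c {ok} 2∣m {n} n%m i j eq with by-residues sameParity? r t m c {ok} i j n n%m eq
  ... | inj₁ (2∣i , 2∣j) = inj₁ (ℕᵈ.∣n∣m%n⇒∣m 2∣m 2∣i , ℕᵈ.∣n∣m%n⇒∣m 2∣m 2∣j)
  ... | inj₂ (2∤i , 2∤j) = inj₂ ((λ p → 2∤i (ℕᵈ.%-presˡ-∣ p 2∣m)) , (λ p → 2∤j (ℕᵈ.%-presˡ-∣ p 2∣m)))

  -- A multiple of one square is treated as a binary form whose second coefficient is 0.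
  insoluble-root : ∀ r m c {_ : True (residues? none? r 0 m c)} →
    ∀ {n} → n ℕ.% suc m ≡ c → ∀ j → r ℕ.* (j ℕ.* j) ≢ n
  insoluble-root r m c {ok} n%m j eq = insoluble r 0 m c {ok} n%m j 0 (trans (ℕ.+-identityʳ _) eq)

  even-root : ∀ r m c {_ : True (residues? (λ a _ → 2 ∣ⁿ? a) r 0 m c)} → 2 ∣ⁿ suc m →
    ∀ {n} → n ℕ.% suc m ≡ c → ∀ j → r ℕ.* (j ℕ.* j) ≡ n → 2 ∣ⁿ j
  even-root r m c {ok} 2∣m {n} n%m j eq =
    ℕᵈ.∣n∣m%n⇒∣m 2∣m (by-residues (λ a _ → 2 ∣ⁿ? a) r 0 m c {ok} j 0 n n%m (trans (ℕ.+-identityʳ _) eq))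

  pairs-zero : ∀ r t n k → (∀ i j → r ℕ.* (i ℕ.* i) ℕ.+ t ℕ.* (j ℕ.* j) ≢ n) → pairs r t n k ≡ 0ℤ
  pairs-zero r t n k ≢n = ∑-zero k λ i _ _ → ∑-zero k λ j _ _ → χ-no (_ ℕ.≟ n) (≢n i j)

  unsigned-zero : ∀ r n k → (∀ j → r ℕ.* (j ℕ.* j) ≢ n) → unsigned r n k ≡ 0ℤ
  unsigned-zero r n k ≢n = ∑-zero k λ j _ _ → χ-no (_ ℕ.≟ n) (≢n j)

  signed-zero : ∀ r n k → (∀ j → r ℕ.* (j ℕ.* j) ≢ n) → signed r n k ≡ 0ℤ
  signed-zero r n k ≢n =
      ∑-zero k λ j _ _ → trans (cong (sgnPow -1ℤ j *_) (χ-no (_ ℕ.≟ n) (≢n j))) (ℤ.*-zeroʳ (sgnPow -1ℤ j))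

  square-dilate : ∀ r d j → r ℕ.* ((d ℕ.* j) ℕ.* (d ℕ.* j)) ≡ d ℕ.* d ℕ.* (r ℕ.* (j ℕ.* j))
  square-dilate = ℕS.solve 3 (λ r d j → r ℕS.:* ((d ℕS.:* j) ℕS.:* (d ℕS.:* j))
         ℕS.:= d ℕS.:* d ℕS.:* (r ℕS.:* (j ℕS.:* j))) refl

  form-dilate : ∀ r t i j → r ℕ.* ((2 ℕ.* i) ℕ.* (2 ℕ.* i)) ℕ.+ t ℕ.* ((2 ℕ.* j) ℕ.* (2 ℕ.* j))
    ≡ 4 ℕ.* (r ℕ.* (i ℕ.* i) ℕ.+ t ℕ.* (j ℕ.* j))
  form-dilate r t i j =
      trans (cong₂ ℕ._+_ (square-dilate r 2 i) (square-dilate t 2 j)) (sym (ℕ.*-distribˡ-+ 4 (r ℕ.* (i ℕ.* i)) (t ℕ.* (j ℕ.* j))))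

  χ-*-cancel : ∀ d .{{_ : ℕ.NonZero d}} {x} m n → x ≡ d ℕ.* m → χ (x ℕ.≟ d ℕ.* n) ≡ χ (m ℕ.≟ n)
  χ-*-cancel d {x} m n refl = χ-cong (d ℕ.* m ℕ.≟ d ℕ.* n) (m ℕ.≟ n) (ℕ.*-cancelˡ-≡ m n d) (cong (d ℕ.*_))

  -- Halving both coordinates is a bijection from the solutions for `4 * n` to those for `n`, which
  -- also explains the doubled range.
  pairs-4 : ∀ r t n k → (∀ i j → r ℕ.* (i ℕ.* i) ℕ.+ t ℕ.* (j ℕ.* j) ≡ 4 ℕ.* n → BothEven i j) →
    pairs r t (4 ℕ.* n) (2 ℕ.* k) ≡ pairs r t n k
  pairs-4 r t n k even = trans
    (∑∑-even k (λ i j → χ (r ℕ.* (i ℕ.* i) ℕ.+ t ℕ.* (j ℕ.* j) ℕ.≟ 4 ℕ.* n)) λ i j odd → χ-no (_ ℕ.≟ 4 ℕ.* n) (odd ∘ even i j))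
    (∑-cong k λ i _ _ → ∑-cong k λ j _ _ → χ-*-cancel 4 (r ℕ.* (i ℕ.* i) ℕ.+ t ℕ.* (j ℕ.* j)) n (form-dilate r t i j))

  sgnPow-double : ∀ j → sgnPow -1ℤ (2 ℕ.* j) ≡ 1ℤ
  sgnPow-double zero    = refl
  sgnPow-double (suc j) =
      trans (cong (sgnPow -1ℤ) (ℕ.*-suc 2 j)) (cong (λ s → -1ℤ * (-1ℤ * s)) (sgnPow-double j))

  -- The surviving indices are even, so the signs disappear on passing from `4 * n` to `n`.
  signed-4 : ∀ r n k → (∀ j → r ℕ.* (j ℕ.* j) ≡ 4 ℕ.* n → 2 ∣ⁿ j) → signed r (4 ℕ.* n) (2 ℕ.* k) ≡ unsigned r n k
  signed-4 r n k even = trans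
    (∑-multiples 2 k (λ j → sgnPow -1ℤ j * χ (r ℕ.* (j ℕ.* j) ℕ.≟ 4 ℕ.* n)) λ j 2∤j →
      trans (cong (sgnPow -1ℤ j *_) (χ-no (_ ℕ.≟ 4 ℕ.* n) (2∤j ∘ even j))) (ℤ.*-zeroʳ (sgnPow -1ℤ j)))
    (∑-cong k λ j _ _ → trans (cong₂ _*_ (sgnPow-double j) (χ-*-cancel 4 (r ℕ.* (j ℕ.* j)) n (square-dilate r 2 j))) (ℤ.*-identityˡ _))

  unsigned-4 : ∀ r n k → (∀ j → r ℕ.* (j ℕ.* j) ≡ 4 ℕ.* n → 2 ∣ⁿ j) → unsigned r (4 ℕ.* n) (2 ℕ.* k) ≡ unsigned r n k
  unsigned-4 r n k even = trans
    (∑-multiples 2 k (λ j → χ (r ℕ.* (j ℕ.* j) ℕ.≟ 4 ℕ.* n)) λ j 2∤j → χ-no (_ ℕ.≟ 4 ℕ.* n) (2∤j ∘ even j))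
    (∑-cong k λ j _ _ → χ-*-cancel 4 (r ℕ.* (j ℕ.* j)) n (square-dilate r 2 j))

  even-or-odd : ∀ j → (∃ λ i → j ≡ 2 ℕ.* i) ⊎ (∃ λ i → j ≡ suc (2 ℕ.* i))
  even-or-odd zero    = inj₁ (0 , refl)
  even-or-odd (suc j) with even-or-odd j
  ... | inj₁ (i , refl) = inj₂ (i , refl)
  ... | inj₂ (i , refl) = inj₁ (suc i , sym (ℕ.*-suc 2 i))

  Odd : ℕ → Set
  Odd j = ¬ 2 ∣ⁿ j

  odd? : ∀ j → Dec (Odd j)
  odd? j = ¬? (2 ∣ⁿ? j)

  odd-suc : ∀ {j} → 2 ∣ⁿ j → Odd (suc j)
  odd-suc {j} 2∣j 2∣1+j = ℕ.<⇒≱ (s≤s (s≤s z≤n)) (ℕᵈ.∣⇒≤ (ℕᵈ.∣m+n∣m⇒∣n (subst (2 ∣ⁿ_) (ℕ.+-comm 1 j) 2∣1+j) 2∣j))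

  odd-form : ∀ {j} → Odd j → ∃ λ i → j ≡ suc (2 ℕ.* i)
  odd-form {j} 2∤j with even-or-odd j
  ... | inj₁ (i , refl) = contradiction (ℕᵈ.m∣m*n i) 2∤j
  ... | inj₂ j≡         = j≡

  signed-even : ∀ r n k → (∀ j → r ℕ.* (j ℕ.* j) ≡ n → 2 ∣ⁿ j) → signed r n k ≡ unsigned r n k
  signed-even r n k even = ∑-cong k λ j _ _ → term j
    where
    term : ∀ j → sgnPow -1ℤ j * χ (r ℕ.* (j ℕ.* j) ℕ.≟ n) ≡ χ (r ℕ.* (j ℕ.* j) ℕ.≟ n)
    term j with r ℕ.* (j ℕ.* j) ℕ.≟ n
    ... | no _   = ℤ.*-zeroʳ (sgnPow -1ℤ j)
    ... | yes eq with even j eq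
    ...   | ℕᵈ.divides i refl =
        trans (ℤ.*-identityʳ _) (trans (cong (sgnPow -1ℤ) (ℕ.*-comm i 2)) (sgnPow-double i))

  -- Measures the signs lost in `signed-4`: termwise, (-1)^j plus twice the indicator of odd j is 1.
  signed+2*odd : ∀ r n k → signed r n k + + 2 * ∑ k (λ j → χ (odd? j ×-dec (r ℕ.* (j ℕ.* j) ℕ.≟ n))) ≡ unsigned r n k
  signed+2*odd r n k = trans (cong (_+_ (signed r n k)) (*-distribˡ-∑ k (+ 2) odd))
    (trans (sym (∑-+ k (λ j → sgnPow -1ℤ j * χ (r ℕ.* (j ℕ.* j) ℕ.≟ n)) (λ j → + 2 * odd j))) (∑-cong k λ j _ _ → term j))
    where
    odd : ℕ → ℤ
    odd j = χ (odd? j ×-dec (r ℕ.* (j ℕ.* j) ℕ.≟ n))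
    term : ∀ j → sgnPow -1ℤ j * χ (r ℕ.* (j ℕ.* j) ℕ.≟ n) + + 2 * odd j ≡ χ (r ℕ.* (j ℕ.* j) ℕ.≟ n)
    term j with r ℕ.* (j ℕ.* j) ℕ.≟ n
    ... | no ¬eq =
        cong₂ (λ x y → x + + 2 * y) (ℤ.*-zeroʳ (sgnPow -1ℤ j)) (χ-no (odd? j ×-dec no ¬eq) (¬eq ∘ proj₂))
    ... | yes eq with even-or-odd j
    ...   | inj₁ (i , refl) = cong₂ (λ x y → x * 1ℤ + + 2 * y) (sgnPow-double i)
                                (χ-no (odd? (2 ℕ.* i) ×-dec yes eq) λ p → proj₁ p (ℕᵈ.m∣m*n i))
    ...   | inj₂ (i , refl) = cong₂ (λ x y → -1ℤ * x * 1ℤ + + 2 * y) (sgnPow-double i)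
                                (χ-yes (odd? (suc (2 ℕ.* i)) ×-dec yes eq) (odd-suc (ℕᵈ.m∣m*n i) , eq))

-- An involution on the odd solutions of x² + 3y² = 2n

module EisensteinInvolution where

  open ℕᵈ using () renaming (_∣_ to _∣ⁿ_; _∣?_ to _∣ⁿ?_)
  open ≡
  open PowerSeries
  open Representations
  open ℕS using (solve; _:=_; _:+_; _:*_; con)

  odd+odd : ∀ {i j} → Odd i → Odd j → 2 ∣ⁿ i ℕ.+ j
  odd+odd i-odd j-odd with odd-form i-odd | odd-form j-odd
  ... | a , refl | b , refl = ℕᵈ.divides (suc (a ℕ.+ b))
    (solve 2 (λ a b → (con 1 :+ con 2 :* a) :+ (con 1 :+ con 2 :* b) := (con 1 :+ (a :+ b)) :* con 2) refl a b)

  odd-sum : ∀ {u v w} → u ℕ.+ v ≡ 2 ℕ.* w → Odd v → Odd u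
  odd-sum {u} {v} {w} eq v-odd 2∣u = v-odd (ℕᵈ.∣m+n∣m⇒∣n (subst (2 ∣ⁿ_) (sym eq) (ℕᵈ.m∣m*n w)) 2∣u)

  odd-triple : ∀ {j} → Odd j → Odd (3 ℕ.* j)
  odd-triple {j} j-odd = odd-sum {3 ℕ.* j} {j} {2 ℕ.* j} (solve 1 (λ j → con 3 :* j :+ j
         := con 2 :* (con 2 :* j)) refl j) j-odd

  odd-positive : ∀ {j} → Odd j → 1 ≤ j
  odd-positive {zero}  j-odd = contradiction (ℕᵈ._∣0 2) j-odd
  odd-positive {suc j} _     = s≤s z≤n

  x≤x*x : ∀ x → x ≤ x ℕ.* x
  x≤x*x zero    = z≤n
  x≤x*x (suc x) = ℕ.m≤m*n (suc x) (suc x)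

  square-injective : ∀ {m n} → m ℕ.* m ≡ n ℕ.* n → m ≡ n
  square-injective {m} {n} eq with ℕ.<-cmp m n
  ... | tri< m<n _ _ = contradiction eq (ℕ.<⇒≢ (ℕ.*-mono-< m<n m<n))
  ... | tri≈ _ m≡n _ = m≡n
  ... | tri> _ _ n<m = contradiction (sym eq) (ℕ.<⇒≢ (ℕ.*-mono-< n<m n<m))

  norm : ℕ → ℕ → ℕ
  norm x y = x ℕ.* x ℕ.+ 3 ℕ.* (y ℕ.* y)

  -- u² = (w − v)² without subtraction.
  cosine : ∀ u v {w} → u ℕ.+ v ≡ w → u ℕ.* u ℕ.+ 2 ℕ.* (v ℕ.* w) ≡ w ℕ.* w ℕ.+ v ℕ.* v
  cosine u v refl = solve 2 (λ u v → u :* u :+ con 2 :* (v :* (u :+ v))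
         := (u :+ v) :* (u :+ v) :+ v :* v) refl u v

  -- Multiplying x + y√-3 by (1 + √-3)/2 gives the second coordinate (x + y)/2; multiplying by (1 -
  -- √-3)/2 gives the first coordinate (x + 3y)/2. Only this sum is recorded. The other coordinate,
  -- |x - 3y|/2 or |x - y|/2, is determined by the converse `Half` in `Partner`.
  data Half (x y x′ y′ : ℕ) : Set where
    half-sum    : 2 ℕ.* y′ ≡ x ℕ.+ y → Half x y x′ y′
    half-triple : 2 ℕ.* x′ ≡ x ℕ.+ 3 ℕ.* y → Half x y x′ y′

  -- Up to signs, x′ + y′√−3 is the product of x + y√−3 with a primitive sixth root of unity, in a form that is
  -- symmetric and free of subtraction.
  Partner : ℕ → ℕ → ℕ → ℕ → Set
  Partner x y x′ y′ = Half x y x′ y′ × Half x′ y′ x y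

  partner-sym : ∀ {x y x′ y′} → Partner x y x′ y′ → Partner x′ y′ x y
  partner-sym (p , q) = q , p

  -- Both norms equal 4y² - 4yy′ + 4y′², which is symmetric in y and y′; adding 4yy′ avoids
  -- subtraction.
  norm-++ : ∀ x y x′ y′ → 2 ℕ.* y′ ≡ x ℕ.+ y → 2 ℕ.* y ≡ x′ ℕ.+ y′ → norm x′ y′ ≡ norm x y
  norm-++ x y x′ y′ p q = ℕ.+-cancelʳ-≡ (4 ℕ.* (y ℕ.* y′)) _ _ (begin
    norm x′ y′ ℕ.+ 4 ℕ.* (y ℕ.* y′)
      ≡⟨ solve 3 (λ x y z → x :* x :+ con 3 :* (y :* y) :+ con 4 :* (z :* y)
             := (x :* x :+ con 2 :* (y :* (con 2 :* z))) :+ con 3 :* (y :* y)) refl x′ y′ y ⟩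
    x′ ℕ.* x′ ℕ.+ 2 ℕ.* (y′ ℕ.* (2 ℕ.* y)) ℕ.+ 3 ℕ.* (y′ ℕ.* y′)
      ≡⟨ cong (ℕ._+ 3 ℕ.* (y′ ℕ.* y′)) (cosine x′ y′ (sym q)) ⟩
    2 ℕ.* y ℕ.* (2 ℕ.* y) ℕ.+ y′ ℕ.* y′ ℕ.+ 3 ℕ.* (y′ ℕ.* y′)
      ≡⟨ solve 2 (λ y z → con 2 :* y :* (con 2 :* y) :+ z :* z :+ con 3 :* (z :* z)
             := con 2 :* z :* (con 2 :* z) :+ y :* y :+ con 3 :* (y :* y)) refl y y′ ⟩
    2 ℕ.* y′ ℕ.* (2 ℕ.* y′) ℕ.+ y ℕ.* y ℕ.+ 3 ℕ.* (y ℕ.* y)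
      ≡⟨ cong (ℕ._+ 3 ℕ.* (y ℕ.* y)) (sym (cosine x y (sym p))) ⟩
    x ℕ.* x ℕ.+ 2 ℕ.* (y ℕ.* (2 ℕ.* y′)) ℕ.+ 3 ℕ.* (y ℕ.* y)
      ≡⟨ solve 3 (λ x y z → (x :* x :+ con 2 :* (y :* (con 2 :* z))) :+ con 3 :* (y :* y)
             := x :* x :+ con 3 :* (y :* y) :+ con 4 :* (y :* z)) refl x y y′ ⟩
    norm x y ℕ.+ 4 ℕ.* (y ℕ.* y′) ∎)
    where open ≡-Reasoning

  -- Both norms equal 4x² - 12xy′ + 12y′².
  norm-+3 : ∀ x y x′ y′ → 2 ℕ.* y′ ≡ x ℕ.+ y → 2 ℕ.* x ≡ x′ ℕ.+ 3 ℕ.* y′ → norm x′ y′ ≡ norm x y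
  norm-+3 x y x′ y′ p q = ℕ.+-cancelʳ-≡ (12 ℕ.* (x ℕ.* y′)) _ _ (begin
    norm x′ y′ ℕ.+ 12 ℕ.* (x ℕ.* y′)
      ≡⟨ solve 3 (λ x y z → x :* x :+ con 3 :* (y :* y) :+ con 12 :* (z :* y)
             := (x :* x :+ con 2 :* (con 3 :* y :* (con 2 :* z))) :+ con 3 :* (y :* y)) refl x′ y′ x ⟩
    x′ ℕ.* x′ ℕ.+ 2 ℕ.* (3 ℕ.* y′ ℕ.* (2 ℕ.* x)) ℕ.+ 3 ℕ.* (y′ ℕ.* y′)
      ≡⟨ cong (ℕ._+ 3 ℕ.* (y′ ℕ.* y′)) (cosine x′ (3 ℕ.* y′) (sym q)) ⟩
    2 ℕ.* x ℕ.* (2 ℕ.* x) ℕ.+ 3 ℕ.* y′ ℕ.* (3 ℕ.* y′) ℕ.+ 3 ℕ.* (y′ ℕ.* y′)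
      ≡⟨ solve 2 (λ x z → con 2 :* x :* (con 2 :* x) :+ con 3 :* z :* (con 3 :* z) :+ con 3 :* (z :* z)
             := x :* x :+ con 3 :* (con 2 :* z :* (con 2 :* z) :+ x :* x)) refl x y′ ⟩
    x ℕ.* x ℕ.+ 3 ℕ.* (2 ℕ.* y′ ℕ.* (2 ℕ.* y′) ℕ.+ x ℕ.* x)
      ≡⟨ cong (λ z → x ℕ.* x ℕ.+ 3 ℕ.* z) (sym (cosine y x (trans (ℕ.+-comm y x) (sym p)))) ⟩
    x ℕ.* x ℕ.+ 3 ℕ.* (y ℕ.* y ℕ.+ 2 ℕ.* (x ℕ.* (2 ℕ.* y′)))
      ≡⟨ solve 3 (λ x y z → x :* x :+ con 3 :* (y :* y :+ con 2 :* (x :* (con 2 :* z)))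
             := x :* x :+ con 3 :* (y :* y) :+ con 12 :* (x :* z)) refl x y y′ ⟩
    norm x y ℕ.+ 12 ℕ.* (x ℕ.* y′) ∎)
    where open ≡-Reasoning

  -- Three times either norm is 4x² - 4xx′ + 4x′²; the factor 3 lets 3y and 3y′ be eliminated
  -- without division.
  norm-33 : ∀ x y x′ y′ → 2 ℕ.* x′ ≡ x ℕ.+ 3 ℕ.* y → 2 ℕ.* x ≡ x′ ℕ.+ 3 ℕ.* y′ → norm x′ y′ ≡ norm x y
  norm-33 x y x′ y′ p q = ℕ.*-cancelˡ-≡ _ _ 3 (ℕ.+-cancelʳ-≡ (4 ℕ.* (x ℕ.* x′)) _ _ (begin
    3 ℕ.* norm x′ y′ ℕ.+ 4 ℕ.* (x ℕ.* x′)
      ≡⟨ solve 3 (λ x y z → con 3 :* (x :* x :+ con 3 :* (y :* y)) :+ con 4 :* (z :* x)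
             := (con 3 :* y :* (con 3 :* y) :+ con 2 :* (x :* (con 2 :* z))) :+ con 3 :* (x :* x))
             refl x′ y′ x ⟩
    3 ℕ.* y′ ℕ.* (3 ℕ.* y′) ℕ.+ 2 ℕ.* (x′ ℕ.* (2 ℕ.* x)) ℕ.+ 3 ℕ.* (x′ ℕ.* x′)
      ≡⟨ cong (ℕ._+ 3 ℕ.* (x′ ℕ.* x′)) (cosine (3 ℕ.* y′) x′ (trans (ℕ.+-comm (3 ℕ.* y′) x′) (sym q))) ⟩
    2 ℕ.* x ℕ.* (2 ℕ.* x) ℕ.+ x′ ℕ.* x′ ℕ.+ 3 ℕ.* (x′ ℕ.* x′)
      ≡⟨ solve 2 (λ y z → con 2 :* y :* (con 2 :* y) :+ z :* z :+ con 3 :* (z :* z)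
             := con 2 :* z :* (con 2 :* z) :+ y :* y :+ con 3 :* (y :* y)) refl x x′ ⟩
    2 ℕ.* x′ ℕ.* (2 ℕ.* x′) ℕ.+ x ℕ.* x ℕ.+ 3 ℕ.* (x ℕ.* x)
      ≡⟨ cong (ℕ._+ 3 ℕ.* (x ℕ.* x)) (sym (cosine (3 ℕ.* y) x (trans (ℕ.+-comm (3 ℕ.* y) x) (sym p)))) ⟩
    3 ℕ.* y ℕ.* (3 ℕ.* y) ℕ.+ 2 ℕ.* (x ℕ.* (2 ℕ.* x′)) ℕ.+ 3 ℕ.* (x ℕ.* x)
      ≡⟨ solve 3 (λ x y z → (con 3 :* y :* (con 3 :* y) :+ con 2 :* (x :* (con 2 :* z))) :+ con 3 :* (x :* x)
             := con 3 :* (x :* x :+ con 3 :* (y :* y)) :+ con 4 :* (x :* z)) refl x y x′ ⟩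
    3 ℕ.* norm x y ℕ.+ 4 ℕ.* (x ℕ.* x′) ∎))
    where open ≡-Reasoning

  partner-norm : ∀ {x y x′ y′} → Partner x y x′ y′ → norm x′ y′ ≡ norm x y
  partner-norm {x} {y} {x′} {y′} (half-sum p    , half-sum q)    = norm-++ x y x′ y′ p q
  partner-norm {x} {y} {x′} {y′} (half-sum p    , half-triple q) = norm-+3 x y x′ y′ p q
  partner-norm {x} {y} {x′} {y′} (half-triple p , half-sum q)    = sym (norm-+3 x′ y′ x y q p)
  partner-norm {x} {y} {x′} {y′} (half-triple p , half-triple q) = norm-33 x y x′ y′ p q

  OddPartner : ℕ → ℕ → Set
  OddPartner x y = ∃₂ λ x′ y′ → Odd x′ × Odd y′ × Partner x y x′ y′

  difference′ : ∀ {u w} → u < w → ∃ λ e → w ≡ e ℕ.+ u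
  difference′ {u} {w} u<w = w ℕ.∸ u , sym (ℕ.m∸n+n≡m (ℕ.<⇒≤ u<w))

  -- With x = 2a + 1 and y = 2b + 1, the numbers (x + y)/2 = a + b + 1 and (x + 3y)/2 = a + 3b + 2
  -- have opposite parity, so the parity of a + b selects the sixth root of unity. The sign of x -
  -- 3y, respectively x - y, then selects the converse half.
  odd-partner : ∀ {x y} → Odd x → Odd y → x ≢ 3 ℕ.* y → OddPartner x y
  odd-partner {x} {y} x-odd y-odd x≢3y with odd-form x-odd | odd-form y-odd
  ... | a , refl | b , refl with 2 ∣ⁿ? (a ℕ.+ b)
  ...   | yes 2∣a+b = sum-case (ℕ.<-cmp x (3 ℕ.* y))
    where
    y′ = suc (a ℕ.+ b)
    y′-odd : Odd y′
    y′-odd = odd-suc 2∣a+b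
    2y′ : 2 ℕ.* y′ ≡ x ℕ.+ y
    2y′ = solve 2 (λ a b → con 2 :* (con 1 :+ (a :+ b))
           := (con 1 :+ con 2 :* a) :+ (con 1 :+ con 2 :* b)) refl a b
    sum-case : _ → OddPartner x y
    sum-case (tri≈ _ x≡3y _) = contradiction x≡3y x≢3y
    -- Here x′ = (3y - x)/2, obtained as 2y - y′.
    sum-case (tri< x<3y _ _) with difference′ {y′} {2 ℕ.* y} (ℕ.*-cancelˡ-< 2 _ _ (begin-strict
        2 ℕ.* y′       ≡⟨ 2y′ ⟩
        x ℕ.+ y        <⟨ ℕ.+-monoˡ-< y x<3y ⟩
        3 ℕ.* y ℕ.+ y  ≡⟨ solve 1 (λ y → con 3 :* y :+ y := con 2 :* (con 2 :* y)) refl y ⟩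
        2 ℕ.* (2 ℕ.* y) ∎))
      where open ℕ.≤-Reasoning
    ... | x′ , 2y = x′ , y′ , odd-sum {x′} {y′} {y} (sym 2y) y′-odd , y′-odd , half-sum 2y′ , half-sum 2y
    -- Here x′ = (x - 3y)/2, obtained as 2x - 3y′.
    sum-case (tri> _ _ 3y<x) with difference′ {3 ℕ.* y′} {2 ℕ.* x} (ℕ.*-cancelˡ-< 2 _ _ (begin-strict
        2 ℕ.* (3 ℕ.* y′)     ≡⟨ solve 1 (λ z → con 2 :* (con 3 :* z) := con 3 :* (con 2 :* z)) refl y′ ⟩
        3 ℕ.* (2 ℕ.* y′)     ≡⟨ cong (3 ℕ.*_) 2y′ ⟩
        3 ℕ.* (x ℕ.+ y)      ≡⟨ ℕ.*-distribˡ-+ 3 x y ⟩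
        3 ℕ.* x ℕ.+ 3 ℕ.* y  <⟨ ℕ.+-monoʳ-< (3 ℕ.* x) 3y<x ⟩
        3 ℕ.* x ℕ.+ x        ≡⟨ solve 1 (λ y → con 3 :* y :+ y := con 2 :* (con 2 :* y)) refl x ⟩
        2 ℕ.* (2 ℕ.* x)      ∎))
      where open ℕ.≤-Reasoning
    ... | x′ , 2x =
        x′ , y′ , odd-sum {x′} {3 ℕ.* y′} {x} (sym 2x) (odd-triple y′-odd) , y′-odd , half-sum 2y′ , half-triple 2x
  ...   | no 2∤a+b = triple-case (ℕ.<-cmp a b)
    where
    x′ = a ℕ.+ 3 ℕ.* b ℕ.+ 2
    x′-odd : Odd x′
    x′-odd 2∣x′ = 2∤a+b (ℕᵈ.∣m+n∣m⇒∣n (subst (2 ∣ⁿ_)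
      (solve 2 (λ a b → a :+ con 3 :* b :+ con 2
             := con 2 :* (b :+ con 1) :+ (a :+ b)) refl a b) 2∣x′) (ℕᵈ.m∣m*n (b ℕ.+ 1)))
    2x′ : 2 ℕ.* x′ ≡ x ℕ.+ 3 ℕ.* y
    2x′ = solve 2 (λ a b → con 2 :* (a :+ con 3 :* b :+ con 2)
           := (con 1 :+ con 2 :* a) :+ con 3 :* (con 1 :+ con 2 :* b)) refl a b
    triple-case : _ → OddPartner x y
    triple-case (tri≈ _ refl _) = contradiction (odd+odd-self a) 2∤a+b
      where
      odd+odd-self : ∀ a → 2 ∣ⁿ a ℕ.+ a
      odd+odd-self a = ℕᵈ.divides a (solve 1 (λ a → a :+ a := a :* con 2) refl a)
    -- In the two remaining cases the second coordinate is |x - y|/2 = |a - b|, the `e` of the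
    -- difference.
    triple-case (tri< a<b _ _) with difference′ a<b
    ... | e , refl =
        x′ , y′ , x′-odd , odd-sum {y′} {x′} {y} (trans (ℕ.+-comm y′ x′) (sym 2y)) x′-odd , half-triple 2x′ , half-sum 2y
      where
      y′ = e
      2y : 2 ℕ.* y ≡ x′ ℕ.+ y′
      2y = solve 2 (λ a e → con 2 :* (con 1 :+ con 2 :* (e :+ a))
             := a :+ con 3 :* (e :+ a) :+ con 2 :+ e) refl a e
    triple-case (tri> _ _ b<a) with difference′ b<a
    ... | e , refl = x′ , e , x′-odd , e-odd , half-triple 2x′ , half-triple 2x
      where
      2x : 2 ℕ.* x ≡ x′ ℕ.+ 3 ℕ.* e
      2x = solve 2 (λ b e → con 2 :* (con 1 :+ con 2 :* (e :+ b))
             := (e :+ b) :+ con 3 :* b :+ con 2 :+ con 3 :* e) refl b e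
      e-odd : Odd e
      e-odd 2∣e = odd-sum {3 ℕ.* e} {x′} {x} (trans (ℕ.+-comm (3 ℕ.* e) x′) (sym 2x)) x′-odd (ℕᵈ.∣n⇒∣m*n 3 2∣e)

  norm-cancel-y : ∀ {x u} y → norm x y ≡ norm u y → x ≡ u
  norm-cancel-y y eq = square-injective (ℕ.+-cancelʳ-≡ (3 ℕ.* (y ℕ.* y)) _ _ eq)

  norm-cancel-x : ∀ x {y v} → norm x y ≡ norm x v → y ≡ v
  norm-cancel-x x eq = square-injective (ℕ.*-cancelˡ-≡ _ _ 3 (ℕ.+-cancelˡ-≡ (x ℕ.* x) _ _ eq))

  -- The two equations give x″ = y′ + y, an even number if y and y′ are odd.
  halves-differ : ∀ {x y y′ x″} → Odd y → Odd y′ → Odd x″ → 2 ℕ.* y′ ≡ x ℕ.+ y → 2 ℕ.* x″ ≢ x ℕ.+ 3 ℕ.* y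
  halves-differ {x} {y} {y′} {x″} y-odd y′-odd x″-odd p q =
      x″-odd (subst (2 ∣ⁿ_) (sym x″≡) (odd+odd y′-odd y-odd))
    where
    x″≡ : x″ ≡ y′ ℕ.+ y
    x″≡ = ℕ.*-cancelˡ-≡ _ _ 2 (begin
      2 ℕ.* x″             ≡⟨ q ⟩
      x ℕ.+ 3 ℕ.* y        ≡⟨ solve 2 (λ x y → x :+ con 3 :* y := (x :+ y) :+ con 2 :* y) refl x y ⟩
      x ℕ.+ y ℕ.+ 2 ℕ.* y  ≡⟨ cong (ℕ._+ 2 ℕ.* y) p ⟨
      2 ℕ.* y′ ℕ.+ 2 ℕ.* y ≡⟨ ℕ.*-distribˡ-+ 2 y′ y ⟨
      2 ℕ.* (y′ ℕ.+ y)     ∎)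
      where open ≡-Reasoning

  -- Oddness forces the same kind of half for both partners, which fixes one coordinate; the common
  -- norm fixes the other.
  partner-unique : ∀ {x y x′ y′ x″ y″} → Odd y → Odd x′ → Odd y′ → Odd x″ → Odd y″ →
    Partner x y x′ y′ → Partner x y x″ y″ → x′ ≡ x″ × y′ ≡ y″
  partner-unique {x} {y} {x′} {y′} {x″} {y″} y-odd x′-odd y′-odd x″-odd y″-odd P′ P″
    with trans (partner-norm P′) (sym (partner-norm P″)) | proj₁ P′ | proj₁ P″
  ... | eq | half-sum p | half-triple q =
      contradiction q (halves-differ {x} {y} {y′} {x″} y-odd y′-odd x″-odd p)
  ... | eq | half-triple p | half-sum q =
      contradiction p (halves-differ {x} {y} {y″} {x′} y-odd y″-odd x′-odd q)
  ... | eq | half-sum p | half-sum q with ℕ.*-cancelˡ-≡ y′ y″ 2 (trans p (sym q))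
  ...   | refl = norm-cancel-y y′ eq , refl
  partner-unique {x} {y} {x′} {y′} {x″} {y″} y-odd x′-odd y′-odd x″-odd y″-odd P′ P″
      | eq | half-triple p | half-triple q with ℕ.*-cancelˡ-≡ x′ x″ 2 (trans p (sym q))
  ...   | refl = refl , norm-cancel-x x′ eq

  self-partner : ∀ {x y} → Partner x y x y → x ≢ 3 ℕ.* y → x ≡ y
  self-partner {x} {y} (half-sum p , _) _ = sym (ℕ.+-cancelʳ-≡ y y x (trans (solve 1 (λ y → y :+ y
         := con 2 :* y) refl y) p))
  self-partner {x} {y} (half-triple p , _) x≢3y = contradiction
    (ℕ.+-cancelˡ-≡ x x (3 ℕ.* y) (trans (solve 1 (λ y → y :+ y := con 2 :* y) refl x) p)) x≢3y

  OddSolution : ℕ → ℕ → ℕ → Set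
  OddSolution n x y = Odd x × Odd y × norm x y ≡ 2 ℕ.* n

  oddSolution? : ∀ n x y → Dec (OddSolution n x y)
  oddSolution? n x y = odd? x ×-dec odd? y ×-dec (norm x y ℕ.≟ 2 ℕ.* n)

  module _ (n k : ℕ) (n≤k : n ≤ k) (3∤n : ¬ 3 ∣ⁿ n) where

    half? : ∀ x y x′ y′ → Dec (Half x y x′ y′)
    half? x y x′ y′ = map′ [ half-sum , half-triple ]′ (λ { (half-sum p) → inj₁ p ; (half-triple p) → inj₂ p })
      ((2 ℕ.* y′ ℕ.≟ x ℕ.+ y) ⊎-dec (2 ℕ.* x′ ℕ.≟ x ℕ.+ 3 ℕ.* y))

    Matched : ℕ → ℕ → ℕ → ℕ → Set
    Matched x y x′ y′ = (OddSolution n x y × OddSolution n x′ y′) × Partner x y x′ y′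

    matched? : ∀ x y x′ y′ → Dec (Matched x y x′ y′)
    matched? x y x′ y′ =
        (oddSolution? n x y ×-dec oddSolution? n x′ y′) ×-dec (half? x y x′ y′ ×-dec half? x′ y′ x y)

    -- For x = 3y the norm is 12y², so n = 6y² would be divisible by 3.
    solution≢3y : ∀ {x y} → OddSolution n x y → x ≢ 3 ℕ.* y
    solution≢3y {_} {y} (_ , _ , eq) refl =
        3∤n (ℕᵈ.divides (2 ℕ.* (y ℕ.* y)) (ℕ.*-cancelˡ-≡ _ _ 2 (trans (sym eq)
      (solve 1 (λ y → con 3 :* y :* (con 3 :* y) :+ con 3 :* (y :* y)
             := con 2 :* (con 2 :* (y :* y) :* con 3)) refl y))))

    solution-bound : ∀ {x y} → norm x y ≡ 2 ℕ.* n → x ≤ 2 ℕ.* k × y ≤ 2 ℕ.* k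
    solution-bound {x} {y} eq =
      ℕ.≤-trans (x≤x*x x) (ℕ.≤-trans (ℕ.m≤m+n (x ℕ.* x) (3 ℕ.* (y ℕ.* y))) norm≤) ,
      ℕ.≤-trans (x≤x*x y) (ℕ.≤-trans (ℕ.m≤n*m (y ℕ.* y) 3) (ℕ.≤-trans (ℕ.m≤n+m (3 ℕ.* (y ℕ.* y)) (x ℕ.* x)) norm≤))
      where
      norm≤ : norm x y ≤ 2 ℕ.* k
      norm≤ = ℕ.≤-trans (ℕ.≤-reflexive eq) (ℕ.*-monoʳ-≤ 2 n≤k)

    -- Each odd solution has exactly one partner, and its norm keeps it inside the range. The count
    -- of solutions thus becomes a fourfold sum symmetric under exchange of partners.
    row-sum : ∀ x y → ∑ (2 ℕ.* k) (λ x′ → ∑ (2 ℕ.* k) (λ y′ → χ (matched? x y x′ y′))) ≡ χ (oddSolution? n x y)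
    row-sum x y = by-cases (oddSolution? n x y)
      where
      by-cases : (d : Dec (OddSolution n x y)) → ∑ (2 ℕ.* k) (λ x′ → ∑ (2 ℕ.* k) (λ y′ → χ (matched? x y x′ y′))) ≡ χ d
      by-cases (no ¬s) = ∑-zero (2 ℕ.* k) λ x′ _ _ → ∑-zero (2 ℕ.* k) λ y′ _ _ →
        χ-no (matched? x y x′ y′) (¬s ∘ proj₁ ∘ proj₁)
      by-cases (yes s@(x-odd , y-odd , eq)) with odd-partner x-odd y-odd (solution≢3y s)
      ... | u , v , u-odd , v-odd , P = trans
        (∑-single (2 ℕ.* k) u _ (odd-positive u-odd) (proj₁ bound) λ x′ x′≢u →
          ∑-zero (2 ℕ.* k) λ y′ _ _ → χ-no (matched? x y x′ y′) (x′≢u ∘ proj₁ ∘ unique))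
        (trans (∑-single (2 ℕ.* k) v _ (odd-positive v-odd) (proj₂ bound) λ y′ y′≢v →
          χ-no (matched? x y u y′) (y′≢v ∘ proj₂ ∘ unique))
        (χ-yes (matched? x y u v) ((s , (u-odd , v-odd , u,v-norm)) , P)))
        where
        u,v-norm : norm u v ≡ 2 ℕ.* n
        u,v-norm = trans (partner-norm P) eq
        bound = solution-bound {u} {v} u,v-norm
        unique : ∀ {x′ y′} → Matched x y x′ y′ → x′ ≡ u × y′ ≡ v
        unique ((_ , (x′-odd , y′-odd , _)) , P′) = partner-unique y-odd x′-odd y′-odd u-odd v-odd P′ P

    2n : ∀ x → norm x x ≡ 2 ℕ.* (2 ℕ.* (x ℕ.* x))
    2n x = solve 1 (λ x → x :* x :+ con 3 :* (x :* x) := con 2 :* (con 2 :* (x :* x))) refl x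

    -- A solution that is its own partner has x = y, where x² + 3y² = 2n reads 2x² = n.
    diagonal : ∀ x → 1 ≤ x → x ≤ 2 ℕ.* k → ∑ (2 ℕ.* k) (λ y → χ (matched? x y x y)) ≡ χ (odd? x ×-dec (2 ℕ.* (x ℕ.* x) ℕ.≟ n))
    diagonal x 1≤x x≤2k = trans
      (∑-single (2 ℕ.* k) x _ 1≤x x≤2k λ y y≢x → χ-no (matched? x y x y)
        λ { ((s , _) , P) → y≢x (sym (self-partner P (solution≢3y s))) })
      (χ-cong (matched? x x x x) (odd? x ×-dec (2 ℕ.* (x ℕ.* x) ℕ.≟ n))
        (λ { (((x-odd , _ , eq) , _) , _) → x-odd , ℕ.*-cancelˡ-≡ _ _ 2 (trans (sym (2n x)) eq) })
        (λ { (x-odd , eq) → let s = x-odd , x-odd , trans (2n x) (cong (2 ℕ.*_) eq)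
                                h = half-sum (solve 1 (λ x → con 2 :* x := x :+ x) refl x)
                            in (s , s) , h , h }))

    odd-solutions : ∑ (2 ℕ.* k) (λ x → ∑ (2 ℕ.* k) (λ y → χ (oddSolution? n x y)))
      ≡ ∑ k (λ x → χ (odd? x ×-dec (2 ℕ.* (x ℕ.* x) ℕ.≟ n))) [mod + 2 ]
    odd-solutions = ≡mod-trans
      (≡mod-reflexive (sym (∑-cong (2 ℕ.* k) λ x _ _ → ∑-cong (2 ℕ.* k) λ y _ _ → row-sum x y)))
      (≡mod-trans (∑∑-symmetric (2 ℕ.* k) (λ x y x′ y′ → χ (matched? x y x′ y′)) λ x y x′ y′ →
        χ-cong (matched? x y x′ y′) (matched? x′ y′ x y) swap swap)
      (≡mod-reflexive (trans (∑-cong (2 ℕ.* k) diagonal)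
        -- Beyond `k` nothing satisfies 2x² = n, so the range shrinks from 2k to k.
        (∑-stable {k} _ (ℕ.m≤m+n k _) λ x k<x → χ-no (odd? x ×-dec (2 ℕ.* (x ℕ.* x) ℕ.≟ n))
          λ { (_ , eq) → ℕ.<⇒≱ k<x (ℕ.≤-trans (x≤x*x x) (ℕ.≤-trans (ℕ.m≤n*m (x ℕ.* x) 2) (ℕ.≤-trans (ℕ.≤-reflexive eq) n≤k))) }))))
      where
      swap : ∀ {x y x′ y′} → Matched x y x′ y′ → Matched x′ y′ x y
      swap ((s , s′) , P) = (s′ , s) , partner-sym P

-- The congruences modulo 4 and 8

module Congruences where

  open import Data.Integer using (_+_; _*_; _-_; -_)
  open import Data.Nat using (_^_)
  open ℕᵈ using () renaming (_∣_ to _∣ⁿ_; _∣?_ to _∣ⁿ?_)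
  open ≡
  open PowerSeries
  open Representations
  open EisensteinInvolution
  open ℤS using (solve; _:=_; _:+_; _:*_; _:-_; :-_; con)

  mod-weaken : ∀ {m m′ x y} → m Signed.∣ m′ → x ≡ y [mod m′ ] → x ≡ y [mod m ]
  mod-weaken m∣m′ (mod p) = mod (Signed.∣-trans m∣m′ p)

  mod-scale : ∀ c {m x y} → x ≡ y [mod m ] → c * x ≡ c * y [mod c * m ]
  mod-scale c {m} {x} {y} (mod p) = mod (subst (c * m Signed.∣_)
    (solve 3 (λ c x y → c :* (x :- y) := c :* x :- c :* y) refl c x y) (Signed.*-monoʳ-∣ c p))

  neg-mod-2 : ∀ x → - x ≡ x [mod + 2 ]
  neg-mod-2 x = mod (Signed.divides (- x) (solve 1 (λ x → :- x :- x := :- x :* con (+ 2)) refl x))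

  signed-mod-2 : ∀ r n k → signed r n k ≡ unsigned r n k [mod + 2 ]
  signed-mod-2 r n k =
      ∑-congᵐ k λ j → ≡mod-trans (*-congᵐ (sgnPow-mod-2 j) ≡mod-refl) (≡mod-reflexive (ℤ.*-identityˡ (χ (r ℕ.* (j ℕ.* j) ℕ.≟ n))))
    where
    sgnPow-mod-2 : ∀ j → sgnPow -1ℤ j ≡ 1ℤ [mod + 2 ]
    sgnPow-mod-2 zero    = ≡mod-refl
    sgnPow-mod-2 (suc j) =
        ≡mod-trans (≡mod-reflexive (ℤ.-1*i≡-i (sgnPow -1ℤ j))) (≡mod-trans (neg-mod-2 (sgnPow -1ℤ j)) (sgnPow-mod-2 j))

  squareClasses : ℕ → ℤ
  squareClasses n = unsigned 2 n n + unsigned 3 n n + unsigned 1 n n + unsigned 6 n n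

  -- The quadratic part carries 4 and drops out; the linear part carries 2 and so matters only
  -- modulo 2, where all signs disappear.
  S3bar-mod-4 : ∀ n → S3bar n ≡ const 1ℤ n + + 2 * squareClasses n [mod + 4 ]
  S3bar-mod-4 n = ≡mod-trans (mod-weaken (Signed.divides (+ 2) refl) (S3bar-mod-8 n n ℕ.≤-refl))
    (≡mod-trans (mod (Signed.divides w (solve 3 (λ c s w → (c :+ con (+ 2) :* s :+ con (+ 4) :* w) :- (c :+ con (+ 2) :* s)
           := w :* con (+ 4)) refl (const 1ℤ n) _ w)))
    (+-congᵐ (≡mod-refl {x = const 1ℤ n}) (mod-scale (+ 2)
      (+-congᵐ (+-congᵐ (+-congᵐ (signed-mod-2 2 n n) (signed-mod-2 3 n n)) (drop-sign 1)) (drop-sign 6)))))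
    where
    w =
        unsigned 2 n n + unsigned 12 n n + pairs 2 3 n n + pairs 1 2 n n
        + pairs 2 6 n n + pairs 1 3 n n + pairs 3 6 n n + pairs 1 6 n n
    drop-sign : ∀ r → - signed r n n ≡ unsigned r n n [mod + 2 ]
    drop-sign r = ≡mod-trans (neg-mod-2 (signed r n n)) (signed-mod-2 r n n)

  module _ {p : ℕ} (p-prime : Prime p) .{{_ : ℕ.NonZero p}} where

    -- By primality p divides j; with j = pi the equation r j² = pn becomes rp i² = n.
    unsigned-coprime : ∀ r n → ¬ p ∣ⁿ r → unsigned r (p ℕ.* n) (p ℕ.* n) ≡ unsigned (r ℕ.* p) n n
    unsigned-coprime r n p∤r = trans
      (∑-multiples p n (λ j → χ (r ℕ.* (j ℕ.* j) ℕ.≟ p ℕ.* n)) λ j p∤j → χ-no (_ ℕ.≟ p ℕ.* n) λ eq →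
        [ p∤r , [ p∤j , p∤j ]′ ∘ euclidsLemma j j p-prime ]′
          (euclidsLemma r (j ℕ.* j) p-prime (subst (p ∣ⁿ_) (sym eq) (ℕᵈ.m∣m*n n))))
      (∑-cong n λ j _ _ → χ-*-cancel p (r ℕ.* p ℕ.* (j ℕ.* j)) n
        (ℕS.solve 3 (λ r p j → r ℕS.:* ((p ℕS.:* j) ℕS.:* (p ℕS.:* j))
               ℕS.:= p ℕS.:* (r ℕS.:* p ℕS.:* (j ℕS.:* j))) refl r p j))

    unsigned-multiple : ∀ r n .{{_ : ℕ.NonZero r}} → unsigned (r ℕ.* p) (p ℕ.* n) (p ℕ.* n) ≡ unsigned r n n
    unsigned-multiple r n = trans
      (∑-cong (p ℕ.* n) λ j _ _ → χ-*-cancel p (r ℕ.* (j ℕ.* j)) n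
        (ℕS.solve 3 (λ r p j → r ℕS.:* p ℕS.:* (j ℕS.:* j) ℕS.:= p ℕS.:* (r ℕS.:* (j ℕS.:* j))) refl r p j))
      (∑-stable (λ j → χ (r ℕ.* (j ℕ.* j) ℕ.≟ n)) (ℕ.m≤n*m n p) λ j n<j → χ-no (_ ℕ.≟ n) λ eq →
        ℕ.<⇒≱ n<j (ℕ.≤-trans (x≤x*x j) (ℕ.≤-trans (ℕ.m≤n*m (j ℕ.* j) r) (ℕ.≤-reflexive eq))))

  const-* : ∀ d .{{_ : ℕ.NonZero d}} n → const 1ℤ (d ℕ.* n) ≡ const 1ℤ n
  const-* (suc d) zero    = cong (const 1ℤ) (ℕ.*-zeroʳ d)
  const-* (suc d) (suc n) = refl

  -- Multiplication by 2 exchanges the coefficients 1 and 2, and 3 and 6.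
  S3bar-2n : ∀ n → S3bar (2 ℕ.* n) ≡ S3bar n [mod + 4 ]
  S3bar-2n n = ≡mod-trans (S3bar-mod-4 (2 ℕ.* n)) (≡mod-trans (≡mod-reflexive eq) (≡mod-sym (S3bar-mod-4 n)))
    where
    2-prime : Prime 2
    2-prime = from-yes (prime? 2)
    eq : const 1ℤ (2 ℕ.* n) + + 2 * squareClasses (2 ℕ.* n) ≡ const 1ℤ n + + 2 * squareClasses n
    eq = cong₂ (λ c u → c + + 2 * u) (const-* 2 n) (trans
      (cong₂ _+_ (cong₂ _+_ (cong₂ _+_ (unsigned-multiple 2-prime 1 n) (unsigned-coprime 2-prime 3 n (from-no (2 ∣ⁿ? 3))))
        (unsigned-coprime 2-prime 1 n (from-no (2 ∣ⁿ? 1)))) (unsigned-multiple 2-prime 3 n))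
      (solve 4 (λ u₁ u₂ u₃ u₆ → u₁ :+ u₆ :+ u₂ :+ u₃
             := u₂ :+ u₃ :+ u₁ :+ u₆) refl (unsigned 1 n n) (unsigned 2 n n) (unsigned 3 n n) (unsigned 6 n n)))

  -- Multiplication by 3 exchanges the coefficients 1 and 3, and 2 and 6.
  S3bar-3n : ∀ n → S3bar (3 ℕ.* n) ≡ S3bar n [mod + 4 ]
  S3bar-3n n = ≡mod-trans (S3bar-mod-4 (3 ℕ.* n)) (≡mod-trans (≡mod-reflexive eq) (≡mod-sym (S3bar-mod-4 n)))
    where
    3-prime : Prime 3
    3-prime = from-yes (prime? 3)
    eq : const 1ℤ (3 ℕ.* n) + + 2 * squareClasses (3 ℕ.* n) ≡ const 1ℤ n + + 2 * squareClasses n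
    eq = cong₂ (λ c u → c + + 2 * u) (const-* 3 n) (trans
      (cong₂ _+_ (cong₂ _+_ (cong₂ _+_ (unsigned-coprime 3-prime 2 n (from-no (3 ∣ⁿ? 2))) (unsigned-multiple 3-prime 1 n))
        (unsigned-coprime 3-prime 1 n (from-no (3 ∣ⁿ? 1)))) (unsigned-multiple 3-prime 2 n))
      (solve 4 (λ u₁ u₂ u₃ u₆ → u₆ :+ u₁ :+ u₃ :+ u₂
             := u₂ :+ u₃ :+ u₁ :+ u₆) refl (unsigned 1 n n) (unsigned 2 n n) (unsigned 3 n n) (unsigned 6 n n)))

  S3bar-2^n : ∀ α n → S3bar (2 ^ α ℕ.* n) ≡ S3bar n [mod + 4 ]
  S3bar-2^n zero    n = ≡mod-reflexive (cong S3bar (ℕ.*-identityˡ n))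
  S3bar-2^n (suc α) n = ≡mod-trans (≡mod-reflexive (cong S3bar (ℕ.*-assoc 2 (2 ^ α) n)))
    (≡mod-trans (S3bar-2n (2 ^ α ℕ.* n)) (S3bar-2^n α n))

  -- Substitutes values for the thirteen counts at once; a `refl` argument leaves its count as it
  -- is.
  S3bar-eval : ∀ n k → n ≤ k → ∀ {c s₂ s₃ s₁ s₆ u₂ u₁₂ p₂₃ p₁₂ p₂₆ p₁₃ p₃₆ p₁₆} →
    const 1ℤ n ≡ c → signed 2 n k ≡ s₂ → signed 3 n k ≡ s₃ → signed 1 n k ≡ s₁ → signed 6 n k ≡ s₆ →
    unsigned 2 n k ≡ u₂ → unsigned 12 n k ≡ u₁₂ → pairs 2 3 n k ≡ p₂₃ → pairs 1 2 n k ≡ p₁₂ →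
    pairs 2 6 n k ≡ p₂₆ → pairs 1 3 n k ≡ p₁₃ → pairs 3 6 n k ≡ p₃₆ → pairs 1 6 n k ≡ p₁₆ →
    S3bar n ≡ c + + 2 * (s₂ + s₃ - s₁ - s₆) + + 4 * (u₂ + u₁₂ + p₂₃ + p₁₂ + p₂₆ + p₁₃ + p₃₆ + p₁₆) [mod + 8 ]
  S3bar-eval n k n≤k refl refl refl refl refl refl refl refl refl refl refl refl refl = S3bar-mod-8 n k n≤k

  *4-mod-3 : ∀ n → (4 ℕ.* n) ℕ.% 3 ≡ n ℕ.% 3
  *4-mod-3 n = trans (cong (ℕ._% 3) (ℕS.solve 1 (λ n → ℕS.con 4 ℕS.:* n ℕS.:= n ℕS.:+ n ℕS.:* ℕS.con 3) refl n))
                     (ℕ.[m+kn]%n≡m%n n n 3)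

  *4-mod-4 : ∀ n → (4 ℕ.* n) ℕ.% 4 ≡ 0
  *4-mod-4 n = ℕᵈ.n∣m⇒m%n≡0 (4 ℕ.* n) 4 (ℕᵈ.m∣m*n n)

  const-nonzero : ∀ n {c} → n ℕ.% 3 ≡ suc c → const 1ℤ n ≡ 0ℤ
  const-nonzero (suc n) _ = refl

  2∣4 : 2 ∣ⁿ 4
  2∣4 = ℕᵈ.divides 2 refl

  n≤2n : ∀ n → n ≤ 2 ℕ.* n
  n≤2n n = ℕ.m≤m+n n _

  4n≤2[2n] : ∀ n → 4 ℕ.* n ≤ 2 ℕ.* (2 ℕ.* n)
  4n≤2[2n] n = ℕ.≤-reflexive (ℕ.*-assoc 2 2 n)

  -- Modulo 4, 2x² + 6y² vanishes only for x and y of equal parity. Even solutions are halved; odd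
  -- ones satisfy x² + 3y² = 2n.
  pairs-2-6-4 : ∀ n k → pairs 2 6 (4 ℕ.* n) (2 ℕ.* k)
    ≡ pairs 2 6 n k + ∑ (2 ℕ.* k) (λ x → ∑ (2 ℕ.* k) (λ y → χ (oddSolution? n x y)))
  pairs-2-6-4 n k = begin
    pairs 2 6 (4 ℕ.* n) (2 ℕ.* k)
      ≡⟨ ∑-cong (2 ℕ.* k) (λ i _ _ → trans (∑-cong (2 ℕ.* k) λ j _ _ → split i j) (∑-+ (2 ℕ.* k) (even i) (odd i))) ⟩
    ∑ (2 ℕ.* k) (λ i → ∑ (2 ℕ.* k) (even i) + ∑ (2 ℕ.* k) (odd i))
      ≡⟨ ∑-+ (2 ℕ.* k) (λ i → ∑ (2 ℕ.* k) (even i)) (λ i → ∑ (2 ℕ.* k) (odd i)) ⟩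
    ∑ (2 ℕ.* k) (λ i → ∑ (2 ℕ.* k) (even i)) + ∑ (2 ℕ.* k) (λ i → ∑ (2 ℕ.* k) (odd i))
      ≡⟨ cong (_+ ∑ (2 ℕ.* k) (λ i → ∑ (2 ℕ.* k) (odd i))) (trans
           (∑∑-even k even λ i j ¬even → χ-no (bothEven? i j ×-dec solution? i j) (¬even ∘ proj₁))
           (∑-cong k λ i _ _ → ∑-cong k λ j _ _ → trans
             (χ-cong (bothEven? (2 ℕ.* i) (2 ℕ.* j) ×-dec solution? (2 ℕ.* i) (2 ℕ.* j)) (solution? (2 ℕ.* i) (2 ℕ.* j))
               proj₂ λ eq → (ℕᵈ.m∣m*n i , ℕᵈ.m∣m*n j) , eq)
             (χ-*-cancel 4 (2 ℕ.* (i ℕ.* i) ℕ.+ 6 ℕ.* (j ℕ.* j)) n (form-dilate 2 6 i j)))) ⟩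
    pairs 2 6 n k + ∑ (2 ℕ.* k) (λ i → ∑ (2 ℕ.* k) (odd i)) ∎
    where
    open ≡-Reasoning
    solution? : ∀ i j → Dec (2 ℕ.* (i ℕ.* i) ℕ.+ 6 ℕ.* (j ℕ.* j) ≡ 4 ℕ.* n)
    solution? i j = 2 ℕ.* (i ℕ.* i) ℕ.+ 6 ℕ.* (j ℕ.* j) ℕ.≟ 4 ℕ.* n
    even odd : ℕ → ℕ → ℤ
    even i j = χ (bothEven? i j ×-dec solution? i j)
    odd  i j = χ (oddSolution? n i j)
    2*norm : ∀ i j → 2 ℕ.* norm i j ≡ 2 ℕ.* (i ℕ.* i) ℕ.+ 6 ℕ.* (j ℕ.* j)
    2*norm = ℕS.solve 2 (λ i j → ℕS.con 2 ℕS.:* (i ℕS.:* i ℕS.:+ ℕS.con 3 ℕS.:* (j ℕS.:* j))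
                                 ℕS.:= ℕS.con 2 ℕS.:* (i ℕS.:* i) ℕS.:+ ℕS.con 6 ℕS.:* (j ℕS.:* j)) refl
    2*2n : 2 ℕ.* (2 ℕ.* n) ≡ 4 ℕ.* n
    2*2n = sym (ℕ.*-assoc 2 2 n)
    to : ∀ {i j} → norm i j ≡ 2 ℕ.* n → 2 ℕ.* (i ℕ.* i) ℕ.+ 6 ℕ.* (j ℕ.* j) ≡ 4 ℕ.* n
    to {i} {j} eq = trans (sym (2*norm i j)) (trans (cong (2 ℕ.*_) eq) 2*2n)
    from : ∀ {i j} → 2 ℕ.* (i ℕ.* i) ℕ.+ 6 ℕ.* (j ℕ.* j) ≡ 4 ℕ.* n → norm i j ≡ 2 ℕ.* n
    from {i} {j} eq = ℕ.*-cancelˡ-≡ (norm i j) (2 ℕ.* n) 2 (trans (2*norm i j) (trans eq (sym 2*2n)))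
    split : ∀ i j → χ (solution? i j) ≡ even i j + odd i j
    split i j = by-cases (solution? i j)
      where
      by-cases : (d : Dec (2 ℕ.* (i ℕ.* i) ℕ.+ 6 ℕ.* (j ℕ.* j) ≡ 4 ℕ.* n)) → χ d ≡ even i j + odd i j
      by-cases (no ¬eq) = sym (cong₂ _+_ (χ-no (bothEven? i j ×-dec solution? i j) (¬eq ∘ proj₂))
                                         (χ-no (oddSolution? n i j) λ { (_ , _ , eq) → ¬eq (to {i} {j} eq) }))
      by-cases (yes eq) with same-parity 2 6 3 0 2∣4 (*4-mod-4 n) i j eq
      ... | inj₁ even = sym (cong₂ _+_ (χ-yes (bothEven? i j ×-dec solution? i j) (even , eq))
                                       (χ-no (oddSolution? n i j) λ odd → proj₁ odd (proj₁ even)))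
      ... | inj₂ (i-odd , j-odd) =
          sym (cong₂ _+_ (χ-no (bothEven? i j ×-dec solution? i j) (i-odd ∘ proj₁ ∘ proj₁))
                                       (χ-yes (oddSolution? n i j) (i-odd , j-odd , from {i} {j} eq)))

  -- `o` stands for the odd x with 2x² = n, `o′` for the odd solutions of x² + 3y² = 2n. The lost
  -- signs contribute 2(u - s) = 4o and the gained solutions 4o′; the total is 8o + 4(o′ - o).
  cancel-mod-8 : ∀ u s a b c o o′ → s + + 2 * o ≡ u → o′ ≡ o [mod + 2 ] →
    0ℤ + + 2 * (u + 0ℤ - 0ℤ - 0ℤ) + + 4 * (u + 0ℤ + a + b + (c + o′) + 0ℤ + 0ℤ + 0ℤ)
    ≡ 0ℤ + + 2 * (s + 0ℤ - 0ℤ - 0ℤ) + + 4 * (u + 0ℤ + a + b + c + 0ℤ + 0ℤ + 0ℤ) [mod + 8 ]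
  cancel-mod-8 .(s + + 2 * o) s a b c o o′ refl (mod (Signed.divides w eq)) = mod (Signed.divides (o + w) (begin
    _ ≡⟨ solve 6 (λ s a b c o o′ → let 0′ = con 0ℤ ; u = s :+ con (+ 2) :* o in
           0′ :+ con (+ 2) :* (u :+ 0′ :- 0′ :- 0′) :+ con (+ 4) :* (u :+ 0′ :+ a :+ b :+ (c :+ o′) :+ 0′ :+ 0′ :+ 0′)
           :- (0′ :+ con (+ 2) :* (s :+ 0′ :- 0′ :- 0′) :+ con (+ 4) :* (u :+ 0′ :+ a :+ b :+ c :+ 0′ :+ 0′ :+ 0′))
           := con (+ 8) :* o :+ con (+ 4) :* (o′ :- o)) refl s a b c o o′ ⟩
    + 8 * o + + 4 * (o′ - o)
      ≡⟨ cong (λ x → + 8 * o + + 4 * x) eq ⟩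
    + 8 * o + + 4 * (w * + 2)
      ≡⟨ solve 2 (λ o w → con (+ 8) :* o :+ con (+ 4) :* (w :* con (+ 2)) := (o :+ w) :* con (+ 8)) refl o w ⟩
    (o + w) * + 8 ∎))
    where open ≡-Reasoning

  -- The terms set to zero are squares or multiples of 3 modulo 3, hence never 2. Of the rest, the
  -- forms (2,3) and (1,2) have only even solutions for 4n; `cancel-mod-8` balances 2x² against the
  -- form (2,6).
  S3bar-4n-2-mod-3 : ∀ n → n ℕ.% 3 ≡ 2 → S3bar (4 ℕ.* n) ≡ S3bar n [mod + 8 ]
  S3bar-4n-2-mod-3 n n%3 = ≡mod-trans lhs (≡mod-trans
    (cancel-mod-8 (unsigned 2 n k) (signed 2 n k) (pairs 2 3 n k) (pairs 1 2 n k) (pairs 2 6 n k) _ _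
      (signed+2*odd 2 n k) (odd-solutions n k (n≤2n n) 3∤n))
    (≡mod-sym rhs))
    where
    k = 2 ℕ.* n
    4n%3 : (4 ℕ.* n) ℕ.% 3 ≡ 2
    4n%3 = trans (*4-mod-3 n) n%3
    4n%4 = *4-mod-4 n
    lhs = S3bar-eval (4 ℕ.* n) (2 ℕ.* k) (4n≤2[2n] n)
      (const-nonzero (4 ℕ.* n) 4n%3)
      (signed-4 2 n k (even-root 2 3 0 2∣4 4n%4))
      (signed-zero 3 (4 ℕ.* n) (2 ℕ.* k) (insoluble-root 3 2 2 4n%3))
      (signed-zero 1 (4 ℕ.* n) (2 ℕ.* k) (insoluble-root 1 2 2 4n%3))
      (signed-zero 6 (4 ℕ.* n) (2 ℕ.* k) (insoluble-root 6 2 2 4n%3))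
      (unsigned-4 2 n k (even-root 2 3 0 2∣4 4n%4))
      (unsigned-zero 12 (4 ℕ.* n) (2 ℕ.* k) (insoluble-root 12 2 2 4n%3))
      (pairs-4 2 3 n k (both-even 2 3 3 0 2∣4 4n%4))
      (pairs-4 1 2 n k (both-even 1 2 3 0 2∣4 4n%4))
      (pairs-2-6-4 n k)
      (pairs-zero 1 3 (4 ℕ.* n) (2 ℕ.* k) (insoluble 1 3 2 2 4n%3))
      (pairs-zero 3 6 (4 ℕ.* n) (2 ℕ.* k) (insoluble 3 6 2 2 4n%3))
      (pairs-zero 1 6 (4 ℕ.* n) (2 ℕ.* k) (insoluble 1 6 2 2 4n%3))
    rhs = S3bar-eval n k (n≤2n n)
      (const-nonzero n n%3)
      refl
      (signed-zero 3 n k (insoluble-root 3 2 2 n%3))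
      (signed-zero 1 n k (insoluble-root 1 2 2 n%3))
      (signed-zero 6 n k (insoluble-root 6 2 2 n%3))
      refl
      (unsigned-zero 12 n k (insoluble-root 12 2 2 n%3))
      refl
      refl
      refl
      (pairs-zero 1 3 n k (insoluble 1 3 2 2 n%3))
      (pairs-zero 3 6 n k (insoluble 3 6 2 2 n%3))
      (pairs-zero 1 6 n k (insoluble 1 6 2 2 n%3))
    3∤n : ¬ 3 ∣ⁿ n
    3∤n 3∣n = contradiction (trans (sym (ℕᵈ.n∣m⇒m%n≡0 n 3 3∣n)) n%3) λ ()

  -- Evenness of n enters twice: odd x and y give x² + 3y² ≡ 4 (mod 8), which cannot be 4n, and x² =
  -- n forces x to be even, so that no sign is lost.
  S3bar-4n-1-mod-3 : ∀ n → n ℕ.% 3 ≡ 1 → 2 ∣ⁿ n → S3bar (4 ℕ.* n) ≡ S3bar n [mod + 8 ]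
  S3bar-4n-1-mod-3 n n%3 2∣n = ≡mod-trans lhs (≡mod-sym rhs)
    where
    k = 2 ℕ.* n
    4n%3 : (4 ℕ.* n) ℕ.% 3 ≡ 1
    4n%3 = trans (*4-mod-3 n) n%3
    4n%4 = *4-mod-4 n
    4n%8 : (4 ℕ.* n) ℕ.% 8 ≡ 0
    4n%8 = ℕᵈ.n∣m⇒m%n≡0 (4 ℕ.* n) 8 (ℕᵈ.*-monoʳ-∣ 4 2∣n)
    n%2 : n ℕ.% 2 ≡ 0
    n%2 = ℕᵈ.n∣m⇒m%n≡0 n 2 2∣n
    lhs = S3bar-eval (4 ℕ.* n) (2 ℕ.* k) (4n≤2[2n] n)
      (const-nonzero (4 ℕ.* n) 4n%3)
      (signed-zero 2 (4 ℕ.* n) (2 ℕ.* k) (insoluble-root 2 2 1 4n%3))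
      (signed-zero 3 (4 ℕ.* n) (2 ℕ.* k) (insoluble-root 3 2 1 4n%3))
      (signed-4 1 n k (even-root 1 3 0 2∣4 4n%4))
      (signed-zero 6 (4 ℕ.* n) (2 ℕ.* k) (insoluble-root 6 2 1 4n%3))
      (unsigned-zero 2 (4 ℕ.* n) (2 ℕ.* k) (insoluble-root 2 2 1 4n%3))
      (unsigned-zero 12 (4 ℕ.* n) (2 ℕ.* k) (insoluble-root 12 2 1 4n%3))
      (pairs-zero 2 3 (4 ℕ.* n) (2 ℕ.* k) (insoluble 2 3 2 1 4n%3))
      (pairs-4 1 2 n k (both-even 1 2 3 0 2∣4 4n%4))
      (pairs-zero 2 6 (4 ℕ.* n) (2 ℕ.* k) (insoluble 2 6 2 1 4n%3))
      (pairs-4 1 3 n k (both-even 1 3 7 0 (ℕᵈ.divides 4 refl) 4n%8))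
      (pairs-zero 3 6 (4 ℕ.* n) (2 ℕ.* k) (insoluble 3 6 2 1 4n%3))
      (pairs-4 1 6 n k (both-even 1 6 3 0 2∣4 4n%4))
    rhs = S3bar-eval n k (n≤2n n)
      (const-nonzero n n%3)
      (signed-zero 2 n k (insoluble-root 2 2 1 n%3))
      (signed-zero 3 n k (insoluble-root 3 2 1 n%3))
      (signed-even 1 n k (even-root 1 1 0 (ℕᵈ.divides 1 refl) n%2))
      (signed-zero 6 n k (insoluble-root 6 2 1 n%3))
      (unsigned-zero 2 n k (insoluble-root 2 2 1 n%3))
      (unsigned-zero 12 n k (insoluble-root 12 2 1 n%3))
      (pairs-zero 2 3 n k (insoluble 2 3 2 1 n%3))
      refl
      (pairs-zero 2 6 n k (insoluble 2 6 2 1 n%3))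
      refl
      (pairs-zero 3 6 n k (insoluble 3 6 2 1 n%3))
      refl

  2^-step : ∀ β j m → 2 ^ (2 ℕ.* suc β ℕ.+ j) ℕ.* m ≡ 4 ℕ.* (2 ^ (2 ℕ.* β ℕ.+ j) ℕ.* m)
  2^-step β j m = trans (cong (λ e → 2 ^ (e ℕ.+ j) ℕ.* m) (ℕ.*-suc 2 β))
    (ℕS.solve 2 (λ x m → ℕS.con 2 ℕS.:* (ℕS.con 2 ℕS.:* x) ℕS.:* m
           ℕS.:= ℕS.con 4 ℕS.:* (x ℕS.:* m)) refl (2 ^ (2 ℕ.* β ℕ.+ j)) m)

  -- `Class` carries the residue and parity conditions that have to persist under multiplication by
  -- 4.
  S3bar-4^β : (Class : ℕ → Set) → (∀ {n} → Class n → Class (4 ℕ.* n)) →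
    (∀ n → Class n → S3bar (4 ℕ.* n) ≡ S3bar n [mod + 8 ]) →
    ∀ j m → Class (2 ^ j ℕ.* m) → ∀ β → S3bar (2 ^ (2 ℕ.* β ℕ.+ j) ℕ.* m) ≡ S3bar (2 ^ j ℕ.* m) [mod + 8 ]
  S3bar-4^β Class closed step j m class zero    = ≡mod-refl
  S3bar-4^β Class closed step j m class (suc β) = ≡mod-trans (≡mod-reflexive (cong S3bar (2^-step β j m)))
    (≡mod-trans (step _ (in-class β)) (S3bar-4^β Class closed step j m class β))
    where
    in-class : ∀ β → Class (2 ^ (2 ℕ.* β ℕ.+ j) ℕ.* m)
    in-class zero    = class
    in-class (suc β) = subst Class (sym (2^-step β j m)) (closed (in-class β))

  [3n+2]-mod-3 : ∀ n → (2 ^ 0 ℕ.* (3 ℕ.* n ℕ.+ 2)) ℕ.% 3 ≡ 2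
  [3n+2]-mod-3 n = trans (cong (ℕ._% 3) (ℕS.solve 1 (λ n →
      ℕS.con 1 ℕS.:* (ℕS.con 3 ℕS.:* n ℕS.:+ ℕS.con 2) ℕS.:= ℕS.con 2 ℕS.:+ n ℕS.:* ℕS.con 3) refl n))
    (ℕ.[m+kn]%n≡m%n 2 n 3)

  2[3n+2]-mod-3 : ∀ n → (2 ^ 1 ℕ.* (3 ℕ.* n ℕ.+ 2)) ℕ.% 3 ≡ 1
  2[3n+2]-mod-3 n = trans (cong (ℕ._% 3) (ℕS.solve 1 (λ n →
      ℕS.con 2 ℕS.:* (ℕS.con 3 ℕS.:* n ℕS.:+ ℕS.con 2)
             ℕS.:= ℕS.con 1 ℕS.:+ (n ℕS.:+ n ℕS.:+ ℕS.con 1) ℕS.:* ℕS.con 3) refl n))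
    (ℕ.[m+kn]%n≡m%n 1 (n ℕ.+ n ℕ.+ 1) 3)

  S3bar-2^2β[3n+2] : ∀ β n →
    S3bar (2 ^ (2 ℕ.* β ℕ.+ 0) ℕ.* (3 ℕ.* n ℕ.+ 2)) ≡ S3bar (2 ^ 0 ℕ.* (3 ℕ.* n ℕ.+ 2)) [mod + 8 ]
  S3bar-2^2β[3n+2] β n = S3bar-4^β (λ m → m ℕ.% 3 ≡ 2) (λ {m} m%3 → trans (*4-mod-3 m) m%3) S3bar-4n-2-mod-3
    0 (3 ℕ.* n ℕ.+ 2) ([3n+2]-mod-3 n) β

  -- 2(3n + 2) is even and congruent to 1 modulo 3, a class closed under multiplication by 4.
  S3bar-2^[2β+1][3n+2] : ∀ β n →
    S3bar (2 ^ (2 ℕ.* β ℕ.+ 1) ℕ.* (3 ℕ.* n ℕ.+ 2)) ≡ S3bar (2 ^ 1 ℕ.* (3 ℕ.* n ℕ.+ 2)) [mod + 8 ]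
  S3bar-2^[2β+1][3n+2] β n = S3bar-4^β (λ m → m ℕ.% 3 ≡ 1 × 2 ∣ⁿ m)
    (λ { {m} (m%3 , 2∣m) → trans (*4-mod-3 m) m%3 , ℕᵈ.∣n⇒∣m*n 4 2∣m })
    (λ m (m%3 , 2∣m) → S3bar-4n-1-mod-3 m m%3 2∣m)
    1 (3 ℕ.* n ℕ.+ 2) (2[3n+2]-mod-3 n , ℕᵈ.m∣m*n (3 ℕ.* n ℕ.+ 2)) β

open PowerSeries using (difference)
open Congruences
open import Data.Nat using (_+_; _*_; _^_)
open import Data.Integer using (_-_)
open import Data.Integer.Divisibility using (_∣_)

theorem4p1 : (n α β : ℕ) → 1 ≤ β →
    ((+ 4) ∣ (S3bar (3 * n) - S3bar n))
    × ((j : ℕ) → j ≤ 2 →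
    (+ 4) ∣ (S3bar (2 ^ α * (3 * n + j)) - S3bar (3 * n + j)))
    × ((j : ℕ) → j ≤ 1 →
    (+ 8) ∣ (S3bar (2 ^ (2 * β + j) * (3 * n + 2)) - S3bar (2 ^ j * (3 * n + 2))))
theorem4p1 n α β _ =
  Signed.∣⇒∣ᵤ (difference (S3bar-3n n)) ,
  (λ j _ → Signed.∣⇒∣ᵤ (difference (S3bar-2^n α (3 * n + j)))) ,
  λ { zero          _        → Signed.∣⇒∣ᵤ (difference (S3bar-2^2β[3n+2] β n))
    ; (suc zero)    _        → Signed.∣⇒∣ᵤ (difference (S3bar-2^[2β+1][3n+2] β n))
    ; (suc (suc _)) (s≤s ()) }
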